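{- For every $k\ge1$, the polynomial ring $\mathbb Z[x_1,\ldots,x_k]$ is regularly bi-interpretable with the ring $\mathbb Z$.
   Context: A regular interpretation $(\Gamma,\phi)$ of $\mathbb A$ in $\mathbb B$ is a code of $L(\mathbb B)$-formulas with parameters $\bar y$ defining a subset of $B^n$, an equivalence relation on it and the operations of $\mathbb A$ on the quotient, together with a formula $\phi(\bar y)$ with $\phi(\mathbb B)\ne\emptyset$, such that the resulting structure $\Gamma(\mathbb B,\bar p)\cong\mathbb A$ for every $\bar p\in\phi(\mathbb B)$; a coordinate map is a surjection from the defined subset onto $A$ inducing such an isomorphism. $\mathbb A$ and $\mathbb B$ are regularly bi-interpretable if there are regular interpretations $(\Gamma,\phi)$ of $\mathbb A$ in $\mathbb B$ and $(\Delta,\psi)$ of $\mathbb B$ in $\mathbb A$ and formulas $\theta_{\mathbb A},\theta_{\mathbb B}$ such that for every admissible parameter tuple $\bar r_0$ of the composite interpretation $\Gamma\circ\Delta$ of $\mathbb A$ in $\mathbb A$, $\theta_{\mathbb A}(\bar u,x,\bar r_0)$ defines a coordinate map $\Gamma\circ\Delta(\mathbb A,\bar r_0)\to\mathbb A$, and symmetrically for $\Delta\circ\Gamma$ and $\theta_{\mathbb B}$. -}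

module Defs where

open import Data.Nat using (ℕ; zero; suc) renaming (_+_ to _+ℕ_; _*_ to _*ℕ_)
open import Data.Fin using (Fin; remQuot)
open import Data.Integer as ℤ using (ℤ)
open import Data.List using (List; []; _∷_; map)
open import Data.Product using (Σ; _×_; _,_; proj₁; proj₂)
open import Data.Sum using (_⊎_)
open import Data.Unit using (⊤)
open import Data.Empty using (⊥)
open import Data.Vec.Functional using (_++_) renaming (_∷_ to _∷ᵥ_)
open import Relation.Binary.PropositionalEquality using (_≡_)

infix 2 _⇔_
_⇔_ : Set → Set → Set
P ⇔ Q = (P → Q) × (Q → P)

-- Rings as structures for the ring language {+, -, ·, 0, 1}
-- (equality of the structure is a relation _≈_, so setoid-presented
-- rings such as polynomial rings are allowed).

record RingStr : Set₁ where
  field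
    Carrier : Set
    _≈_     : Carrier → Carrier → Set
    _+_     : Carrier → Carrier → Carrier
    _*_     : Carrier → Carrier → Carrier
    -_      : Carrier → Carrier
    0#      : Carrier
    1#      : Carrier

ℤRing : RingStr
ℤRing = record
  { Carrier = ℤ ; _≈_ = _≡_ ; _+_ = ℤ._+_ ; _*_ = ℤ._*_ ; -_ = ℤ.-_
  ; 0# = ℤ.0ℤ ; 1# = ℤ.1ℤ }

-- R[X]: polynomials as coefficient lists (constant term first),
-- equal iff they agree up to trailing zero coefficients.
module PolyOver (R : RingStr) where
  open RingStr R

  Eqp : List Carrier → List Carrier → Set
  Eqp [] [] = ⊤
  Eqp [] (b ∷ bs) = (b ≈ 0#) × Eqp [] bs
  Eqp (a ∷ as) [] = (a ≈ 0#) × Eqp as []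
  Eqp (a ∷ as) (b ∷ bs) = (a ≈ b) × Eqp as bs

  addp : List Carrier → List Carrier → List Carrier
  addp [] q = q
  addp (a ∷ as) [] = a ∷ as
  addp (a ∷ as) (b ∷ bs) = (a + b) ∷ addp as bs

  mulp : List Carrier → List Carrier → List Carrier
  mulp [] q = []
  mulp (a ∷ as) q = addp (map (a *_) q) (0# ∷ mulp as q)

  _[X] : RingStr
  _[X] = record
    { Carrier = List Carrier ; _≈_ = Eqp ; _+_ = addp ; _*_ = mulp
    ; -_ = map -_ ; 0# = [] ; 1# = 1# ∷ [] }

open PolyOver public using (_[X])

ℤ[x]^ : ℕ → RingStr
ℤ[x]^ zero = ℤRing
ℤ[x]^ (suc k) = (ℤ[x]^ k) [X]

-- First-order formulas of the ring language, in unnested (relational)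
-- form; variables are de Bruijn indices Fin n.

data Formula : ℕ → Set where
  _≐_   : ∀ {n} → Fin n → Fin n → Formula n
  plus  : ∀ {n} → Fin n → Fin n → Fin n → Formula n
  times : ∀ {n} → Fin n → Fin n → Fin n → Formula n
  minus : ∀ {n} → Fin n → Fin n → Formula n
  isZero : ∀ {n} → Fin n → Formula n
  isOne  : ∀ {n} → Fin n → Formula n
  ⊤' ⊥' : ∀ {n} → Formula n
  _∧'_ _∨'_ _⇒'_ : ∀ {n} → Formula n → Formula n → Formula n
  ∃' ∀' : ∀ {n} → Formula (suc n) → Formula n

record RelStr : Set₁ where
  field
    Dom  : Set
    Eq   : Dom → Dom → Set
    Add  : Dom → Dom → Dom → Set
    Mul  : Dom → Dom → Dom → Set
    Neg  : Dom → Dom → Set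
    Zero : Dom → Set
    One  : Dom → Set
open RelStr public

graph : RingStr → RelStr
graph R = record
  { Dom = Carrier
  ; Eq = _≈_
  ; Add = λ a b c → (a + b) ≈ c
  ; Mul = λ a b c → (a * b) ≈ c
  ; Neg = λ a b → (- a) ≈ b
  ; Zero = λ a → a ≈ 0#
  ; One = λ a → a ≈ 1# }
  where open RingStr R

Sat : (S : RelStr) → ∀ {n} → Formula n → (Fin n → Dom S) → Set
Sat S (i ≐ j) ρ = Eq S (ρ i) (ρ j)
Sat S (plus i j k) ρ = Add S (ρ i) (ρ j) (ρ k)
Sat S (times i j k) ρ = Mul S (ρ i) (ρ j) (ρ k)
Sat S (minus i j) ρ = Neg S (ρ i) (ρ j)
Sat S (isZero i) ρ = Zero S (ρ i)
Sat S (isOne i) ρ = One S (ρ i)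
Sat S ⊤' ρ = ⊤
Sat S ⊥' ρ = ⊥
Sat S (φ ∧' ψ) ρ = Sat S φ ρ × Sat S ψ ρ
Sat S (φ ∨' ψ) ρ = Sat S φ ρ ⊎ Sat S ψ ρ
Sat S (φ ⇒' ψ) ρ = Sat S φ ρ → Sat S ψ ρ
Sat S (∃' φ) ρ = Σ (Dom S) λ d → Sat S φ (d ∷ᵥ ρ)
Sat S (∀' φ) ρ = (d : Dom S) → Sat S φ (d ∷ᵥ ρ)

-- Interpretation codes: an n-dimensional interpretation with p
-- parameters. Variable layout: tuple variables first, parameters last.

record Code (n p : ℕ) : Set where
  field
    dom : Formula (n +ℕ p)
    eqv : Formula (n +ℕ (n +ℕ p))
    add : Formula (n +ℕ (n +ℕ (n +ℕ p)))
    mul : Formula (n +ℕ (n +ℕ (n +ℕ p)))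
    neg : Formula (n +ℕ (n +ℕ p))
    zer : Formula (n +ℕ p)
    one : Formula (n +ℕ p)
open Code public

-- Γ(S, p̄): the structure defined by the code in S with parameters p̄
-- (before quotienting by E: its equality is E).
Interp : (S : RelStr) → ∀ {n p} → Code n p → (Fin p → Dom S) → RelStr
Interp S {n} Γ ps = record
  { Dom = Σ (Fin n → Dom S) λ u → Sat S (dom Γ) (u ++ ps)
  ; Eq = λ u v → Sat S (eqv Γ) (proj₁ u ++ (proj₁ v ++ ps))
  ; Add = λ u v w → Sat S (add Γ) (proj₁ u ++ (proj₁ v ++ (proj₁ w ++ ps)))
  ; Mul = λ u v w → Sat S (mul Γ) (proj₁ u ++ (proj₁ v ++ (proj₁ w ++ ps)))
  ; Neg = λ u v → Sat S (neg Γ) (proj₁ u ++ (proj₁ v ++ ps))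
  ; Zero = λ u → Sat S (zer Γ) (proj₁ u ++ ps)
  ; One = λ u → Sat S (one Γ) (proj₁ u ++ ps) }

-- f is a coordinate map S → A: a surjection inducing an isomorphism
-- S/Eq ≅ A (Eq, Add, … are exactly the pullbacks of A's equality and
-- operation graphs).
record IsCoordMap (S : RelStr) (A : RingStr) (f : Dom S → RingStr.Carrier A) : Set where
  open RingStr A
  field
    surj : ∀ a → Σ (Dom S) λ u → f u ≈ a
    eq   : ∀ u v → Eq S u v ⇔ f u ≈ f v
    add  : ∀ u v w → Add S u v w ⇔ (f u + f v) ≈ f w
    mul  : ∀ u v w → Mul S u v w ⇔ (f u * f v) ≈ f w
    neg  : ∀ u v → Neg S u v ⇔ (- f u) ≈ f v
    zer  : ∀ u → Zero S u ⇔ f u ≈ 0#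
    one  : ∀ u → One S u ⇔ f u ≈ 1#

IsRegInterp : (A B : RingStr) → ∀ {n p} → Code n p → Formula p → Set
IsRegInterp A B {n} {p} Γ φ =
  (Σ (Fin p → RingStr.Carrier B) λ ps → Sat (graph B) φ ps) ×
  ((ps : Fin p → RingStr.Carrier B) → Sat (graph B) φ ps →
     Σ (Dom (Interp (graph B) Γ ps) → RingStr.Carrier A)
       (IsCoordMap (Interp (graph B) Γ ps) A))

flat : ∀ {X : Set} {m : ℕ} {P : (Fin m → X) → Set} {k : ℕ} →
       (Fin k → Σ (Fin m → X) P) → Fin (k *ℕ m) → X
flat {m = m} {k = k} u i = proj₁ (u (proj₁ (remQuot {k} m i))) (proj₂ (remQuot {k} m i))

-- θ(ū, x, r̄) defines a coordinate map S → A, where env places the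
-- tuple ū, the element x and the fixed parameters r̄ into θ's variables.
DefinesCoordMap : (S : RelStr) (A : RingStr) → ∀ {k} → Formula k →
                  (Dom S → RingStr.Carrier A → Fin k → RingStr.Carrier A) → Set
DefinesCoordMap S A θ env =
  Σ (Dom S → RingStr.Carrier A) λ f →
    IsCoordMap S A f ×
    (∀ u x → Sat (graph A) θ (env u x) ⇔ RingStr._≈_ A (f u) x)

-- Γ : Code n p interprets A in B, Δ : Code m q interprets B in A.
-- Admissible parameters of Γ∘Δ in A: q̄ ∈ ψ(A) and p̄' a p-tuple of
-- elements of Δ(A,q̄) satisfying φ there; the composite structure is
-- Γ(Δ(A,q̄), p̄'), whose elements are n blocks of m-tuples from A.
-- θ_A has variables (ū : n·m, x, p̄' : p·m, q̄ : q).
CompositeCoord : (A B : RingStr) → ∀ {n p m q} → Code n p → Formula p →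
                 Code m q → Formula q → Formula (n *ℕ m +ℕ suc (p *ℕ m +ℕ q)) → Set
CompositeCoord A B {n} {p} {m} {q} Γ φ Δ ψ θ =
  (qs : Fin q → RingStr.Carrier A) → Sat (graph A) ψ qs →
  (ps : Fin p → Dom (Interp (graph A) Δ qs)) → Sat (Interp (graph A) Δ qs) φ ps →
  DefinesCoordMap (Interp (Interp (graph A) Δ qs) Γ ps) A θ
    (λ u x → flat (proj₁ u) ++ (x ∷ᵥ (flat ps ++ qs)))

RegBiInterpretable : RingStr → RingStr → Set
RegBiInterpretable A B =
  Σ ℕ λ n → Σ ℕ λ p → Σ ℕ λ m → Σ ℕ λ q →
  Σ (Code n p) λ Γ → Σ (Formula p) λ φ →
  Σ (Code m q) λ Δ → Σ (Formula q) λ ψ →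
  IsRegInterp A B Γ φ × IsRegInterp B A Δ ψ ×
  (Σ (Formula (n *ℕ m +ℕ suc (p *ℕ m +ℕ q))) λ θA → CompositeCoord A B Γ φ Δ ψ θA) ×
  (Σ (Formula (m *ℕ n +ℕ suc (q *ℕ n +ℕ p))) λ θB → CompositeCoord B A Δ ψ Γ φ θB)

{-# OPTIONS --safe #-}
module Submission where

-- A = ℤ[x₁,…,x_k] embeds into the functions ℤᵏ → ℤ, and ℤ is definable in A without parameters:
-- the positive integers are the elements that lie in some set { z : z ∣ M, 1 + zt ∣ m } with
-- M ≠ 0 that is closed under predecessor except at 1. The same sets code finite sets of integers,
-- hence Horner evaluations, so that polynomials can be coded by integers with a definable value
-- relation "the polynomial coded by u takes the value c at a"; the ring operations on codes are
-- then pointwise. In A, with parameters y₁,…,y_k, a code u stands for the x with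
-- x ≡ (value of u at a) modulo (y₁ − a₁,…,y_k − a_k) for all integer points a. This defines a
-- coordinate map when y is the tuple of generators, and since being a coordinate map is a
-- first-order condition on y, that condition itself serves as the admissibility formula.

open import Defs
open import Data.Nat as ℕ using (ℕ; zero; suc; _≤_; _<_; _!; z≤n; s≤s)
import Data.Nat.Properties as ℕP
import Data.Nat.Divisibility as ℕD
open import Data.Integer as Int using (ℤ; +_; -[1+_]; ∣_∣)
import Data.Integer.Properties as ℤP
open import Data.Integer.Divisibility.Signed using (divides; ∣ᵤ⇒∣; ∣⇒∣ᵤ)
open import Data.Integer.Tactic.RingSolver using (solve-∀)
open import Data.Fin using (Fin; zero; suc; _↑ˡ_; _↑ʳ_)
open import Data.Fin.Patterns using (0F; 1F; 2F; 3F; 4F; 5F; 6F; 8F; 9F)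
open import Data.List using (List; []; _∷_; map)
open import Data.List.Membership.Propositional using (_∈_)
open import Data.List.Membership.DecPropositional ℤP._≟_ using (_∈?_)
open import Data.List.Relation.Unary.Any using (here; there)
open import Data.Product using (Σ; _×_; _,_; proj₁; proj₂)
open import Data.Sum using (_⊎_; inj₁; inj₂; [_,_]′)
open import Data.Unit using (⊤; tt)
open import Data.Empty using (⊥; ⊥-elim)
open import Data.Vec.Functional using (tail; _++_) renaming (_∷_ to _∷ᵥ_; [] to []ᵥ)
open import Relation.Nullary using (¬_; yes; no; contradiction)
open import Relation.Binary.PropositionalEquality
  using (_≡_; _≢_; refl; sym; trans; cong; cong₂; subst)

-- Logical equivalence

-- Parameters cannot be avoided for A: a substitution such as x₁ ↦ x₁ + 1 is an automorphism of A
-- that fixes ℤ pointwise, so it would have to preserve any coordinate map defined without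
-- parameters. For the same reason no parameter-free formula singles out the tuple of generators.
-- Admissible tuples are therefore handled only through the condition they satisfy, and the
-- generators are needed just to show that some tuple satisfies it. Neither ring has a symbol for
-- the order. In place of the bound z ≤ M of Gödel's β-function stands z ∣ M: for M ≠ 0 it bounds
-- |z| in ℤ, and in A it bounds the value of z at every integer point where M does not vanish. This
-- makes the coded sets finite in ℤ, and in A it stops the descent by which an element is shown to
-- be a constant. Evaluation at all integer points is faithful because ℤ is an infinite domain, so
-- identities in A are checked as identities in ℤ.

⇔-refl : ∀ {P} → P ⇔ P
⇔-refl = (λ p → p) , (λ p → p)

⇔-sym : ∀ {P Q} → P ⇔ Q → Q ⇔ P
⇔-sym (f , g) = g , f

infixr 4 _⇔∘_
_⇔∘_ : ∀ {P Q R} → P ⇔ Q → Q ⇔ R → P ⇔ R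
(f , g) ⇔∘ (h , k) = (λ p → h (f p)) , (λ r → g (k r))

×-⇔ : ∀ {P P′ Q Q′} → P ⇔ P′ → Q ⇔ Q′ → (P × Q) ⇔ (P′ × Q′)
×-⇔ (f , g) (h , k) = (λ (p , q) → f p , h q) , (λ (p , q) → g p , k q)

⊎-⇔ : ∀ {P P′ Q Q′} → P ⇔ P′ → Q ⇔ Q′ → (P ⊎ Q) ⇔ (P′ ⊎ Q′)
⊎-⇔ (f , g) (h , k) =
  (λ { (inj₁ p) → inj₁ (f p) ; (inj₂ q) → inj₂ (h q) }) ,
  (λ { (inj₁ p) → inj₁ (g p) ; (inj₂ q) → inj₂ (k q) })

→-⇔ : ∀ {P P′ Q Q′} → P ⇔ P′ → Q ⇔ Q′ → (P → Q) ⇔ (P′ → Q′)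
→-⇔ (f , g) (h , k) = (λ i p → h (i (g p))) , (λ i p → k (i (f p)))

Σ-⇔ : ∀ {A : Set} {P Q : A → Set} → (∀ a → P a ⇔ Q a) → Σ A P ⇔ Σ A Q
Σ-⇔ e = (λ (a , p) → a , proj₁ (e a) p) , (λ (a , q) → a , proj₂ (e a) q)

Π-⇔ : ∀ {A : Set} {P Q : A → Set} → (∀ a → P a ⇔ Q a) → (∀ a → P a) ⇔ (∀ a → Q a)
Π-⇔ e = (λ p a → proj₁ (e a) (p a)) , (λ q a → proj₂ (e a) (q a))

-- Renaming and congruence of satisfaction

lift : ∀ {n m} → (Fin n → Fin m) → Fin (suc n) → Fin (suc m)
lift f zero    = zero
lift f (suc i) = suc (f i)

rename : ∀ {n m} → (Fin n → Fin m) → Formula n → Formula m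
rename f (i ≐ j)       = f i ≐ f j
rename f (plus i j k)  = plus (f i) (f j) (f k)
rename f (times i j k) = times (f i) (f j) (f k)
rename f (minus i j)   = minus (f i) (f j)
rename f (isZero i)    = isZero (f i)
rename f (isOne i)     = isOne (f i)
rename f ⊤'            = ⊤'
rename f ⊥'            = ⊥'
rename f (φ ∧' ψ)      = rename f φ ∧' rename f ψ
rename f (φ ∨' ψ)      = rename f φ ∨' rename f ψ
rename f (φ ⇒' ψ)      = rename f φ ⇒' rename f ψ
rename f (∃' φ)        = ∃' (rename (lift f) φ)
rename f (∀' φ)        = ∀' (rename (lift f) φ)

module _ (S : RelStr) where

  Sat-rename : ∀ {n m} (f : Fin n → Fin m) φ {ρ ρ′} → (∀ i → ρ (f i) ≡ ρ′ i) →
               Sat S (rename f φ) ρ ⇔ Sat S φ ρ′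
  Sat-rename-bind : ∀ {n m} (f : Fin n → Fin m) φ {ρ ρ′} → (∀ i → ρ (f i) ≡ ρ′ i) →
                    ∀ d → Sat S (rename (lift f) φ) (d ∷ᵥ ρ) ⇔ Sat S φ (d ∷ᵥ ρ′)

  Sat-rename f (i ≐ j) e rewrite e i | e j = ⇔-refl
  Sat-rename f (plus i j k) e rewrite e i | e j | e k = ⇔-refl
  Sat-rename f (times i j k) e rewrite e i | e j | e k = ⇔-refl
  Sat-rename f (minus i j) e rewrite e i | e j = ⇔-refl
  Sat-rename f (isZero i) e rewrite e i = ⇔-refl
  Sat-rename f (isOne i) e rewrite e i = ⇔-refl
  Sat-rename f ⊤' e = ⇔-refl
  Sat-rename f ⊥' e = ⇔-refl
  Sat-rename f (φ ∧' ψ) e = ×-⇔ (Sat-rename f φ e) (Sat-rename f ψ e)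
  Sat-rename f (φ ∨' ψ) e = ⊎-⇔ (Sat-rename f φ e) (Sat-rename f ψ e)
  Sat-rename f (φ ⇒' ψ) e = →-⇔ (Sat-rename f φ e) (Sat-rename f ψ e)
  Sat-rename f (∃' φ) e = Σ-⇔ (Sat-rename-bind f φ e)
  Sat-rename f (∀' φ) e = Π-⇔ (Sat-rename-bind f φ e)

  Sat-rename-bind f φ e d = Sat-rename (lift f) φ λ { zero → refl ; (suc i) → e i }

record IsCongruence (R : RingStr) : Set where
  open RingStr R
  field
    ≈-refl  : ∀ {a} → a ≈ a
    ≈-sym   : ∀ {a b} → a ≈ b → b ≈ a
    ≈-trans : ∀ {a b c} → a ≈ b → b ≈ c → a ≈ c
    +-cong  : ∀ {a a′ b b′} → a ≈ a′ → b ≈ b′ → (a + b) ≈ (a′ + b′)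
    *-cong  : ∀ {a a′ b b′} → a ≈ a′ → b ≈ b′ → (a * b) ≈ (a′ * b′)
    -‿cong  : ∀ {a a′} → a ≈ a′ → (- a) ≈ (- a′)

  ≈-resp : ∀ {a a′ b b′} → a ≈ a′ → b ≈ b′ → (a ≈ b) ⇔ (a′ ≈ b′)
  ≈-resp e f = (λ g → ≈-trans (≈-sym e) (≈-trans g f)) , (λ g → ≈-trans e (≈-trans g (≈-sym f)))

module _ {R : RingStr} (cg : IsCongruence R) where
  open RingStr R
  open IsCongruence cg

  module _ {S : RelStr} {f : Dom S → Carrier} (coord : IsCoordMap S R f) where
    private module C = IsCoordMap coord

    ∷-transfer : ∀ {n} {ρ : Fin n → Dom S} {ρ′ d d′} → f d ≈ d′ → (∀ i → f (ρ i) ≈ ρ′ i) →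
                 ∀ i → f ((d ∷ᵥ ρ) i) ≈ (d′ ∷ᵥ ρ′) i
    ∷-transfer e es zero    = e
    ∷-transfer e es (suc i) = es i

    -- Atoms of `S` are by definition the pullbacks of those of `R`; surjectivity, up to `≈`,
    -- provides the preimages that the quantifiers ask for.
    Sat-transfer : ∀ {n} (φ : Formula n) {ρ ρ′} → (∀ i → f (ρ i) ≈ ρ′ i) →
                   Sat S φ ρ ⇔ Sat (graph R) φ ρ′
    Sat-transfer (i ≐ j) e = C.eq _ _ ⇔∘ ≈-resp (e i) (e j)
    Sat-transfer (plus i j k) e = C.add _ _ _ ⇔∘ ≈-resp (+-cong (e i) (e j)) (e k)
    Sat-transfer (times i j k) e = C.mul _ _ _ ⇔∘ ≈-resp (*-cong (e i) (e j)) (e k)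
    Sat-transfer (minus i j) e = C.neg _ _ ⇔∘ ≈-resp (-‿cong (e i)) (e j)
    Sat-transfer (isZero i) e = C.zer _ ⇔∘ ≈-resp (e i) ≈-refl
    Sat-transfer (isOne i) e = C.one _ ⇔∘ ≈-resp (e i) ≈-refl
    Sat-transfer ⊤' e = ⇔-refl
    Sat-transfer ⊥' e = ⇔-refl
    Sat-transfer (φ ∧' ψ) e = ×-⇔ (Sat-transfer φ e) (Sat-transfer ψ e)
    Sat-transfer (φ ∨' ψ) e = ⊎-⇔ (Sat-transfer φ e) (Sat-transfer ψ e)
    Sat-transfer (φ ⇒' ψ) e = →-⇔ (Sat-transfer φ e) (Sat-transfer ψ e)
    Sat-transfer (∃' φ) e =
      (λ (d , s) → f d , proj₁ (Sat-transfer φ (∷-transfer ≈-refl e)) s) ,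
      (λ (a , s) → proj₁ (C.surj a) , proj₂ (Sat-transfer φ (∷-transfer (proj₂ (C.surj a)) e)) s)
    Sat-transfer (∀' φ) e =
      (λ s a → proj₁ (Sat-transfer φ (∷-transfer (proj₂ (C.surj a)) e)) (s (proj₁ (C.surj a)))) ,
      (λ s d → proj₂ (Sat-transfer φ (∷-transfer ≈-refl e)) (s (f d)))

  identity-coordinate : IsCoordMap (graph R) R λ a → a
  identity-coordinate = record
    { surj = λ a → a , ≈-refl
    ; eq = λ _ _ → ⇔-refl ; add = λ _ _ _ → ⇔-refl ; mul = λ _ _ _ → ⇔-refl
    ; neg = λ _ _ → ⇔-refl ; zer = λ _ → ⇔-refl ; one = λ _ → ⇔-refl }

  Sat-resp : ∀ {n} (φ : Formula n) {ρ ρ′} → (∀ i → ρ i ≈ ρ′ i) →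
             Sat (graph R) φ ρ ⇔ Sat (graph R) φ ρ′
  Sat-resp = Sat-transfer identity-coordinate

⟨_,_,_⟩ : ∀ {A : Set} → A → A → A → Fin 3 → A
⟨ x , y , z ⟩ = x ∷ᵥ y ∷ᵥ z ∷ᵥ []ᵥ

-- Definable relations of a ring

data Term (n : ℕ) : Set where
  var     : Fin n → Term n
  𝟘 𝟙     : Term n
  _⊕_ _⊗_ : Term n → Term n → Term n
  ⊝_      : Term n → Term n

infixl 6 _⊕_
infixl 7 _⊗_

module Definability {R : RingStr} (cg : IsCongruence R) where
  open RingStr R
  open IsCongruence cg

  Env : ℕ → Set
  Env n = Fin n → Carrier

  ⟦_⟧ : ∀ {n} → Term n → Env n → Carrier
  ⟦ var i ⟧ ρ = ρ i
  ⟦ 𝟘 ⟧ ρ     = 0#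
  ⟦ 𝟙 ⟧ ρ     = 1#
  ⟦ s ⊕ t ⟧ ρ = ⟦ s ⟧ ρ + ⟦ t ⟧ ρ
  ⟦ s ⊗ t ⟧ ρ = ⟦ s ⟧ ρ * ⟦ t ⟧ ρ
  ⟦ ⊝ t ⟧ ρ   = - ⟦ t ⟧ ρ

  -- Carrying the meaning along with the formula lets definable predicates be assembled by
  -- connectives that mirror the logic, without inspecting the resulting formulas.
  record Def (n : ℕ) (P : Env n → Set) : Set where
    constructor def
    field
      formula : Formula n
      correct : ∀ ρ → Sat (graph R) formula ρ ⇔ P ρ
  open Def public

  def-resp : ∀ {n P Q} → (∀ ρ → P ρ ⇔ Q ρ) → Def n P → Def n Q
  def-resp e (def φ c) = def φ λ ρ → c ρ ⇔∘ e ρ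

  respects : ∀ {n P} → Def n P → ∀ {ρ ρ′} → (∀ i → ρ i ≈ ρ′ i) → P ρ → P ρ′
  respects (def φ c) e p = proj₁ (c _) (proj₁ (Sat-resp cg φ e) (proj₂ (c _) p))

  reindex : ∀ {n m P} (f : Fin n → Fin m) → Def n P → Def m λ ρ → P λ i → ρ (f i)
  reindex f (def φ c) = def (rename f φ) λ ρ → Sat-rename _ f φ (λ _ → refl) ⇔∘ c _

  ternaryᵈ : ∀ {n} (φ : Formula 3) (u v w : Fin n) → Def n λ ρ → Sat (graph R) φ ⟨ ρ u , ρ v , ρ w ⟩
  ternaryᵈ φ u v w = def (rename ⟨ u , v , w ⟩ φ)
    λ ρ → Sat-rename _ _ φ λ { 0F → refl ; 1F → refl ; 2F → refl }

  infixr 3 _∧ᵈ_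
  infixr 2 _∨ᵈ_
  infixr 1 _⇒ᵈ_

  _∧ᵈ_ : ∀ {n P Q} → Def n P → Def n Q → Def n λ ρ → P ρ × Q ρ
  def φ c ∧ᵈ def ψ d = def (φ ∧' ψ) λ ρ → ×-⇔ (c ρ) (d ρ)

  _∨ᵈ_ : ∀ {n P Q} → Def n P → Def n Q → Def n λ ρ → P ρ ⊎ Q ρ
  def φ c ∨ᵈ def ψ d = def (φ ∨' ψ) λ ρ → ⊎-⇔ (c ρ) (d ρ)

  _⇒ᵈ_ : ∀ {n P Q} → Def n P → Def n Q → Def n λ ρ → P ρ → Q ρ
  def φ c ⇒ᵈ def ψ d = def (φ ⇒' ψ) λ ρ → →-⇔ (c ρ) (d ρ)

  ⊥ᵈ : ∀ {n} → Def n λ _ → ⊥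
  ⊥ᵈ = def ⊥' λ _ → ⇔-refl

  ∃ᵈ : ∀ {n} {P : Carrier → Env n → Set} →
       Def (suc n) (λ ρ → P (ρ zero) (λ i → ρ (suc i))) → Def n λ ρ → Σ Carrier λ d → P d ρ
  ∃ᵈ (def φ c) = def (∃' φ) λ ρ → Σ-⇔ λ d → c (d ∷ᵥ ρ)

  ∀ᵈ : ∀ {n} {P : Carrier → Env n → Set} →
       Def (suc n) (λ ρ → P (ρ zero) (λ i → ρ (suc i))) → Def n λ ρ → ∀ d → P d ρ
  ∀ᵈ (def φ c) = def (∀' φ) λ ρ → Π-⇔ λ d → c (d ∷ᵥ ρ)

  -- Formulas are unnested, so the value of each subterm has to be named by an existential
  -- quantifier.
  graphᵈ : ∀ {n} (t : Term n) → Def (suc n) λ ρ → ⟦ t ⟧ (λ i → ρ (suc i)) ≈ ρ zero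
  graphᵈ (var i) = def (suc i ≐ zero) λ _ → ⇔-refl
  graphᵈ 𝟘 = def (isZero zero) λ _ → ≈-sym , ≈-sym
  graphᵈ 𝟙 = def (isOne zero) λ _ → ≈-sym , ≈-sym
  graphᵈ (s ⊕ t) = def-resp
    (λ ρ → (λ (_ , e , _ , f , g) → ≈-trans (+-cong e f) g) , (λ e → _ , ≈-refl , _ , ≈-refl , e))
    summands
    where
    summands : Def _ λ ρ → Σ Carrier λ a → (⟦ s ⟧ (λ i → ρ (suc i)) ≈ a) ×
                             Σ Carrier λ b → (⟦ t ⟧ (λ i → ρ (suc i)) ≈ b) × ((a + b) ≈ ρ zero)
    summands = ∃ᵈ (reindex (lift suc) (graphᵈ s) ∧ᵈ
                   ∃ᵈ (reindex (lift (λ i → suc (suc i))) (graphᵈ t) ∧ᵈ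
                       def (plus (suc zero) zero (suc (suc zero))) λ _ → ⇔-refl))
  graphᵈ (s ⊗ t) = def-resp
    (λ ρ → (λ (_ , e , _ , f , g) → ≈-trans (*-cong e f) g) , (λ e → _ , ≈-refl , _ , ≈-refl , e))
    factors
    where
    factors : Def _ λ ρ → Σ Carrier λ a → (⟦ s ⟧ (λ i → ρ (suc i)) ≈ a) ×
                            Σ Carrier λ b → (⟦ t ⟧ (λ i → ρ (suc i)) ≈ b) × ((a * b) ≈ ρ zero)
    factors = ∃ᵈ (reindex (lift suc) (graphᵈ s) ∧ᵈ
                  ∃ᵈ (reindex (lift (λ i → suc (suc i))) (graphᵈ t) ∧ᵈ
                      def (times (suc zero) zero (suc (suc zero))) λ _ → ⇔-refl))
  graphᵈ (⊝ t) = def-resp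
    (λ ρ → (λ (_ , e , f) → ≈-trans (-‿cong e) f) , (λ e → _ , ≈-refl , e))
    argument
    where
    argument : Def _ λ ρ → Σ Carrier λ a → (⟦ t ⟧ (λ i → ρ (suc i)) ≈ a) × ((- a) ≈ ρ zero)
    argument = ∃ᵈ (reindex (lift suc) (graphᵈ t) ∧ᵈ def (minus zero (suc zero)) λ _ → ⇔-refl)

  infix 4 _≈ᵈ_
  _≈ᵈ_ : ∀ {n} (s t : Term n) → Def n λ ρ → ⟦ s ⟧ ρ ≈ ⟦ t ⟧ ρ
  s ≈ᵈ t = def-resp (λ ρ → (λ (_ , e , f) → ≈-trans e (≈-sym f)) , (λ e → _ , e , ≈-refl)) common
    where
    common : Def _ λ ρ → Σ Carrier λ a → (⟦ s ⟧ ρ ≈ a) × (⟦ t ⟧ ρ ≈ a)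
    common = ∃ᵈ (graphᵈ s ∧ᵈ graphᵈ t)

  Fin-∀ᵈ : ∀ k {n} {P : Fin k → Env n → Set} → (∀ i → Def n (P i)) → Def n λ ρ → ∀ i → P i ρ
  Fin-∀ᵈ zero d = def ⊤' λ _ → (λ _ ()) , (λ _ → tt)
  Fin-∀ᵈ (suc k) {P = P} d = def-resp
    (λ ρ → (λ { (p , q) zero → p ; (p , q) (suc i) → q i }) , (λ p → p zero , λ i → p (suc i)))
    (d zero ∧ᵈ Fin-∀ᵈ k λ i → d (suc i))

  -- A tuple taken apart into its entries is recovered only up to pointwise equality, which `P` must
  -- therefore respect.
  tuple-∀ᵈ : ∀ k {n} {P : Env k → Env n → Set} →
             (∀ {a b ρ} → (∀ i → a i ≡ b i) → P a ρ → P b ρ) →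
             Def (k ℕ.+ n) (λ ρ → P (λ i → ρ (i ↑ˡ n)) (λ i → ρ (k ↑ʳ i))) →
             Def n λ ρ → ∀ a → P a ρ
  tuple-∀ᵈ zero ext d = def-resp (λ ρ → (λ p a → ext (λ ()) p) , (λ p → p _)) d
  tuple-∀ᵈ (suc k) {n} {P} ext d = def-resp
    (λ ρ → (λ p a → ext (λ { zero → refl ; (suc i) → refl }) (p (λ i → a (suc i)) (a zero))) ,
           (λ p a x → p (x ∷ᵥ a)))
    (tuple-∀ᵈ k (λ e p x → ext (λ { zero → refl ; (suc i) → e i }) (p x)) (∀ᵈ body))
    where
    body : Def (suc k ℕ.+ n)
               λ ρ → P (ρ zero ∷ᵥ λ i → ρ (suc (i ↑ˡ n))) (λ i → ρ (suc (k ↑ʳ i)))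
    body = def-resp (λ ρ → ext (λ { zero → refl ; (suc i) → refl }) ,
                           ext (λ { zero → refl ; (suc i) → refl })) d

-- Relativisation to a definable subset

module _ (δ : Formula 1) where

  domain : ∀ {n} → Formula (suc n)
  domain = rename (λ _ → zero) δ

  -- The q parameters are dummies.
  inducedCode : ∀ q → Code 1 q
  inducedCode q = record
    { dom = domain
    ; eqv = zero ≐ suc zero
    ; add = plus zero (suc zero) (suc (suc zero))
    ; mul = times zero (suc zero) (suc (suc zero))
    ; neg = minus zero (suc zero)
    ; zer = isZero zero
    ; one = isOne zero }

  relativise : ∀ {n} → Formula n → Formula n
  relativise (φ ∧' ψ) = relativise φ ∧' relativise ψ
  relativise (φ ∨' ψ) = relativise φ ∨' relativise ψ
  relativise (φ ⇒' ψ) = relativise φ ⇒' relativise ψ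
  relativise (∃' φ)   = ∃' (domain ∧' relativise φ)
  relativise (∀' φ)   = ∀' (domain ⇒' relativise φ)
  relativise φ        = φ

module _ {R : RingStr} (δ : Formula 1) where
  open RingStr R

  -- `domain` reads variable zero alone, so its truth can be moved between a tuple followed by
  -- parameters and a bound variable followed by an environment.
  Sat-domain : ∀ {n} (ρ : Fin (suc n) → Carrier) {x} → ρ zero ≡ x →
               Sat (graph R) (domain δ) ρ ⇔ Sat (graph R) δ λ _ → x
  Sat-domain ρ e = Sat-rename (graph R) (λ _ → zero) δ λ _ → e

  Sat-relativise : ∀ {q n} {qs : Fin q → Carrier} (φ : Formula n)
                   {ρ : Fin n → Dom (Interp (graph R) (inducedCode δ q) qs)} {ρ′} →
                   (∀ i → proj₁ (ρ i) zero ≡ ρ′ i) →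
                   Sat (Interp (graph R) (inducedCode δ q) qs) φ ρ ⇔ Sat (graph R) (relativise δ φ) ρ′
  Sat-relativise-bind : ∀ {q n} {qs : Fin q → Carrier} (φ : Formula (suc n))
    {ρ : Fin n → Dom (Interp (graph R) (inducedCode δ q) qs)} {ρ′} →
    (∀ i → proj₁ (ρ i) zero ≡ ρ′ i) → ∀ d {x} → proj₁ d zero ≡ x →
    Sat (Interp (graph R) (inducedCode δ q) qs) φ (d ∷ᵥ ρ) ⇔ Sat (graph R) (relativise δ φ) (x ∷ᵥ ρ′)

  Sat-relativise (i ≐ j) e rewrite sym (e i) | sym (e j) = ⇔-refl
  Sat-relativise (plus i j k) e rewrite sym (e i) | sym (e j) | sym (e k) = ⇔-refl
  Sat-relativise (times i j k) e rewrite sym (e i) | sym (e j) | sym (e k) = ⇔-refl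
  Sat-relativise (minus i j) e rewrite sym (e i) | sym (e j) = ⇔-refl
  Sat-relativise (isZero i) e rewrite sym (e i) = ⇔-refl
  Sat-relativise (isOne i) e rewrite sym (e i) = ⇔-refl
  Sat-relativise ⊤' e = ⇔-refl
  Sat-relativise ⊥' e = ⇔-refl
  Sat-relativise (φ ∧' ψ) e = ×-⇔ (Sat-relativise φ e) (Sat-relativise ψ e)
  Sat-relativise (φ ∨' ψ) e = ⊎-⇔ (Sat-relativise φ e) (Sat-relativise ψ e)
  Sat-relativise (φ ⇒' ψ) e = →-⇔ (Sat-relativise φ e) (Sat-relativise ψ e)
  Sat-relativise (∃' φ) e =
    (λ ((u , δu) , s) → u zero ,
       proj₂ (Sat-domain _ refl) (proj₁ (Sat-domain _ refl) δu) ,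
       proj₁ (Sat-relativise-bind φ e (u , δu) refl) s) ,
    (λ (x , δx , s) → let δu = proj₂ (Sat-domain _ refl) (proj₁ (Sat-domain _ refl) δx) in
       ((λ _ → x) , δu) , proj₂ (Sat-relativise-bind φ e ((λ _ → x) , δu) refl) s)
  Sat-relativise (∀' φ) e =
    (λ s x δx → let δu = proj₂ (Sat-domain _ refl) (proj₁ (Sat-domain _ refl) δx) in
       proj₁ (Sat-relativise-bind φ e ((λ _ → x) , δu) refl) (s ((λ _ → x) , δu))) ,
    (λ s (u , δu) → proj₂ (Sat-relativise-bind φ e (u , δu) refl)
       (s (u zero) (proj₂ (Sat-domain _ refl) (proj₁ (Sat-domain _ refl) δu))))

  Sat-relativise-bind φ e d e₀ =
    Sat-relativise φ λ { zero → e₀ ; (suc i) → e i }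

-- Coding finite sets of integers

module _ (R : RingStr) where
  open RingStr R

  Divides : Carrier → Carrier → Set
  Divides x y = Σ Carrier λ d → (d * x) ≈ y

  -- (M, m, t) is a code for the set of these z.
  Member : (M m t z : Carrier) → Set
  Member M m t z = Divides z M × Divides (1# + (z * t)) m

module IntegerArithmetic where
  open Int using (_+_; _*_; -_; _-_)

  -- A polynomial injection of ℤ into ℕ, whose values x(2x + 1) are the triangular numbers; it
  -- removes signs by means of ring operations only.
  2x²+x : ℤ → ℤ
  2x²+x x = x * x + x * x + x

  opaque
    -- With a and b the images of x and y in ℕ this is (a + b)² + a + 1. The final 1 keeps pairs
    -- apart from 0, which codes the empty list and cannot belong to a coded set with M ≠ 0.
    pair : ℤ → ℤ → ℤ
    pair x y = (2x²+x x + 2x²+x y) * (2x²+x x + 2x²+x y) + 2x²+x x + + 1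

  2x²+x-∣∣ : ∀ x → Σ ℕ λ n → 2x²+x x ≡ + n × ∣ x ∣ ≤ n
  2x²+x-∣∣ (+ n) =
    n ℕ.* n ℕ.+ n ℕ.* n ℕ.+ n ,
    cong (λ z → z + z + + n) (sym (ℤP.pos-* n n)) ,
    ℕP.m≤n+m n _
  2x²+x-∣∣ -[1+ n ] =
    suc n ℕ.* suc n ℕ.+ suc n ℕ.* n ,
    trans (factor (+ n)) (sym (cong₂ _+_ (ℤP.pos-* (suc n) (suc n)) (ℤP.pos-* (suc n) n))) ,
    ℕP.≤-trans (ℕP.m≤m*n (suc n) (suc n)) (ℕP.m≤m+n _ _)
    where
    factor : ∀ N → let x = - (+ 1 + N) in x * x + x * x + x ≡ (+ 1 + N) * (+ 1 + N) + (+ 1 + N) * N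
    factor = solve-∀

  -- The difference of the two values is x - y times an odd number.
  2x²+x-injective : ∀ x y → 2x²+x x ≡ 2x²+x y → x ≡ y
  2x²+x-injective x y e
    with ℤP.i*j≡0⇒i≡0∨j≡0 (x - y) (trans (factor x y) (ℤP.i≡j⇒i-j≡0 e))
    where
    factor : ∀ x y → (x - y) * (+ 1 + + 2 * (x + y)) ≡ (x * x + x * x + x) - (y * y + y * y + y)
    factor = solve-∀
  ... | inj₁ x-y≡0 = ℤP.i-j≡0⇒i≡j x y x-y≡0
  ... | inj₂ odd≡0 = ⊥-elim (odd (x + y) odd≡0)
    where
    even≢1 : ∀ n → 2 ℕ.* n ≢ 1
    even≢1 (suc n) e rewrite ℕP.+-suc n (n ℕ.+ 0) = contradiction e λ ()
    odd : ∀ z → + 1 + + 2 * z ≢ + 0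
    odd z e = even≢1 ∣ z ∣ (trans (sym (ℤP.abs-* (+ 2) z)) (cong ∣_∣ 2z≡-1))
      where
      2z≡-1 : + 2 * z ≡ -[1+ 0 ]
      2z≡-1 = trans (shift (+ 2 * z)) (cong (_- + 1) e)
        where
        shift : ∀ v → v ≡ + 1 + v - + 1
        shift = solve-∀

  -- From a ≤ s it follows that s² + a lies strictly below (s + 1)², so s is the integer part of the
  -- square root.
  s²+a-injective : ∀ {s a s′ a′} → a ≤ s → a′ ≤ s′ → s ℕ.* s ℕ.+ a ≡ s′ ℕ.* s′ ℕ.+ a′ → s ≡ s′
  s²+a-injective a≤s a′≤s′ e =
    ℕP.≤-antisym (ℕP.≮⇒≥ λ s′<s → bound a′≤s′ s′<s (sym e)) (ℕP.≮⇒≥ λ s<s′ → bound a≤s s<s′ e)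
    where
    bound : ∀ {s a s′ a′} → a ≤ s → s < s′ → s ℕ.* s ℕ.+ a ≢ s′ ℕ.* s′ ℕ.+ a′
    bound {s} {a} {s′} {a′} a≤s s<s′ = ℕP.<⇒≢ (begin-strict
      s ℕ.* s ℕ.+ a            ≤⟨ ℕP.+-monoʳ-≤ (s ℕ.* s) a≤s ⟩
      s ℕ.* s ℕ.+ s            ≡⟨ ℕP.+-comm (s ℕ.* s) s ⟩
      suc s ℕ.* s              <⟨ ℕP.*-monoʳ-< (suc s) (ℕP.n<1+n s) ⟩
      suc s ℕ.* suc s          ≤⟨ ℕP.*-mono-≤ s<s′ s<s′ ⟩
      s′ ℕ.* s′                ≤⟨ ℕP.m≤m+n _ a′ ⟩
      s′ ℕ.* s′ ℕ.+ a′         ∎)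
      where open ℕP.≤-Reasoning

  opaque
    unfolding pair

    pair-ℕ : ∀ x y → let (a , _) = 2x²+x-∣∣ x ; (b , _) = 2x²+x-∣∣ y in
             pair x y ≡ + suc ((a ℕ.+ b) ℕ.* (a ℕ.+ b) ℕ.+ a)
    pair-ℕ x y with 2x²+x-∣∣ x | 2x²+x-∣∣ y
    ... | a , e , _ | b , f , _ rewrite e | f | sym (ℤP.pos-* (a ℕ.+ b) (a ℕ.+ b)) =
      cong +_ (ℕP.+-comm _ 1)

  pair≢0 : ∀ x y → pair x y ≢ + 0
  pair≢0 x y e = contradiction (trans (sym (pair-ℕ x y)) e) λ ()

  pair-injective : ∀ x y x′ y′ → pair x y ≡ pair x′ y′ → x ≡ x′ × y ≡ y′
  pair-injective x y x′ y′ e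
    with 2x²+x-∣∣ x | 2x²+x-∣∣ y | 2x²+x-∣∣ x′ | 2x²+x-∣∣ y′
       | trans (sym (pair-ℕ x y)) (trans e (pair-ℕ x′ y′))
  ... | a , p , _ | b , q , _ | a′ , p′ , _ | b′ , q′ , _ | e′ =
    2x²+x-injective x x′ (trans p (trans (cong +_ a≡a′) (sym p′))) ,
    2x²+x-injective y y′ (trans q (trans (cong +_ b≡b′) (sym q′)))
    where
    squares : (a ℕ.+ b) ℕ.* (a ℕ.+ b) ℕ.+ a ≡ (a′ ℕ.+ b′) ℕ.* (a′ ℕ.+ b′) ℕ.+ a′
    squares = ℕP.suc-injective (ℤP.+-injective e′)
    a+b≡a′+b′ : a ℕ.+ b ≡ a′ ℕ.+ b′
    a+b≡a′+b′ = s²+a-injective (ℕP.m≤m+n a b) (ℕP.m≤m+n a′ b′) squares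
    a≡a′ : a ≡ a′
    a≡a′ = ℕP.+-cancelˡ-≡ ((a ℕ.+ b) ℕ.* (a ℕ.+ b)) a a′
             (trans squares (cong (λ s → s ℕ.* s ℕ.+ a′) (sym a+b≡a′+b′)))
    b≡b′ : b ≡ b′
    b≡b′ = ℕP.+-cancelˡ-≡ a b b′ (trans a+b≡a′+b′ (cong (ℕ._+ b′) (sym a≡a′)))

  -- The tail of a coded list has a smaller code than the list; this is the measure for the descent
  -- in `Trace⇒Value`.
  ∣y∣<∣pair∣ : ∀ x y → ∣ y ∣ < ∣ pair x y ∣
  ∣y∣<∣pair∣ x y with 2x²+x-∣∣ x | 2x²+x-∣∣ y | pair-ℕ x y
  ... | a , _ , _ | b , _ , ∣y∣≤b | e rewrite e =
    s≤s (ℕP.≤-trans ∣y∣≤b (ℕP.≤-trans (ℕP.m≤n+m b a) (ℕP.≤-trans (n≤n*n (a ℕ.+ b)) (ℕP.m≤m+n _ a))))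
    where
    n≤n*n : ∀ n → n ≤ n ℕ.* n
    n≤n*n zero    = z≤n
    n≤n*n (suc n) = ℕP.m≤m*n (suc n) (suc n)

  ∣K! : ∀ {K} z → z ≢ + 0 → ∣ z ∣ ≤ K → Divides ℤRing z (+ (K !))
  ∣K! z z≢0 z≤K with ∣ᵤ⇒∣ {z} (ℕD.∣-trans (n∣n! ∣ z ∣ λ e → z≢0 (ℤP.∣i∣≡0⇒i≡0 e)) (ℕD.m≤n⇒m!∣n! z≤K))
    where
    n∣n! : ∀ n → n ≢ 0 → n ℕD.∣ (n !)
    n∣n! zero    n≢0 = contradiction refl n≢0
    n∣n! (suc n) _   = ℕD.m∣m*n (n !)
  ... | divides q e = q , sym e

  Divides⇒≤ : ∀ {z M} → M ≢ + 0 → Divides ℤRing z M → ∣ z ∣ ≤ ∣ M ∣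
  Divides⇒≤ {z} {M} M≢0 (d , e) = ℕD.∣⇒≤ {{Int.≢-nonZero M≢0}} (∣⇒∣ᵤ (divides d (sym e)))

  product-1+zt : ℤ → List ℤ → ℤ
  product-1+zt t []      = + 1
  product-1+zt t (l ∷ L) = (+ 1 + l * t) * product-1+zt t L

  ∈⇒1+zt∣product : ∀ {t z} L → z ∈ L → Divides ℤRing (+ 1 + z * t) (product-1+zt t L)
  ∈⇒1+zt∣product {t} (l ∷ L) (here refl) = product-1+zt t L , ℤP.*-comm (product-1+zt t L) _
  ∈⇒1+zt∣product {t} {z} (l ∷ L) (there z∈L) =
    let (d , e) = ∈⇒1+zt∣product L z∈L
    in (+ 1 + l * t) * d , trans (ℤP.*-assoc (+ 1 + l * t) d _) (cong ((+ 1 + l * t) *_) e)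

  bezout : ∀ z l {t} → Divides ℤRing (l - z) t →
           Σ ℤ λ x → Σ ℤ λ y → x * (+ 1 + z * t) + y * (+ 1 + l * t) ≡ + 1
  bezout z l (q , refl) =
    -- From l(1 + zt) - z(1 + lt) = l - z one gets t after multiplying by q; substitute this into 1
    -- = (1 + zt) - zt. The first coefficient is 1 - zql.
    + 1 - z * (q * (l - z)) - z * z * q , z * z * q , identity z l q
    where
    identity : ∀ z l q → let t = q * (l - z) in
               (+ 1 - z * t - z * z * q) * (+ 1 + z * t) + z * z * q * (+ 1 + l * t) ≡ + 1
    identity = solve-∀

  coprime-to-product : ∀ {t z} L → (∀ {l} → l ∈ L → Divides ℤRing (l - z) t) →
    Divides ℤRing (+ 1 + z * t) (product-1+zt t L) → Divides ℤRing (+ 1 + z * t) (+ 1)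
  coprime-to-product [] _ d = d
  coprime-to-product {t} {z} (l ∷ L) δ (d , e) =
    let (x , y , b) = bezout z l (δ (here refl))
    in coprime-to-product L (λ l∈L → δ (there l∈L))
         (x * P + y * d ,
          trans (regroup x y d P z t) (trans (cong (λ w → x * (+ 1 + z * t) * P + y * w) e)
            (trans (collect x y P (+ 1 + z * t) (+ 1 + l * t)) (trans (cong (_* P) b) (ℤP.*-identityˡ P)))))
    where
    P = product-1+zt t L
    regroup : ∀ x y d P z t → (x * P + y * d) * (+ 1 + z * t) ≡
                              x * (+ 1 + z * t) * P + y * (d * (+ 1 + z * t))
    regroup = solve-∀
    collect : ∀ x y P a b → x * a * P + y * (b * P) ≡ (x * a + y * b) * P
    collect = solve-∀

  bound : List ℤ → ℕ
  bound []      = 0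
  bound (l ∷ L) = ∣ l ∣ ℕ.+ bound L

  ∈⇒≤bound : ∀ {z} L → z ∈ L → ∣ z ∣ ≤ bound L
  ∈⇒≤bound (l ∷ L) (here refl) = ℕP.m≤m+n _ _
  ∈⇒≤bound (l ∷ L) (there z∈L) = ℕP.≤-trans (∈⇒≤bound L z∈L) (ℕP.m≤n+m _ _)

  -- A divisor of 1 has absolute value 1, which would give |3w| ≤ 2.
  1+3w∤1 : ∀ {w} → w ≢ + 0 → ¬ Divides ℤRing (+ 1 + w * + 3) (+ 1)
  1+3w∤1 {w} w≢0 (d , e) = ℕP.<⇒≱ (ℕP.≤-trans (ℕP.*-monoˡ-≤ 3 1≤∣w∣) (ℕP.≤-reflexive (sym (ℤP.abs-* w (+ 3)))))
    (ℕP.≤-trans (ℕP.≤-reflexive (cong ∣_∣ (shift (w * + 3))))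
      (ℕP.≤-trans (ℤP.∣i-j∣≤∣i∣+∣j∣ (+ 1 + w * + 3) (+ 1)) (ℕP.≤-reflexive (cong (ℕ._+ 1) unit))))
    where
    1≤∣w∣ : 1 ≤ ∣ w ∣
    1≤∣w∣ = ℕP.n≢0⇒n>0 λ p → w≢0 (ℤP.∣i∣≡0⇒i≡0 p)
    shift : ∀ v → v ≡ + 1 + v - + 1
    shift = solve-∀
    unit : ∣ + 1 + w * + 3 ∣ ≡ 1
    unit = ℕP.m*n≡1⇒n≡1 ∣ d ∣ _ (trans (sym (ℤP.abs-* d _)) (cong ∣_∣ e))

  -- t is a multiple of every l − z with l ∈ L and z ∣ M, so 1 + zt is prime to the
  -- product over L as soon as z ∉ L; the factor 3 keeps 1 + zt from being a unit.
  finite-sets-coded : ∀ L → (∀ {l} → l ∈ L → l ≢ + 0) →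
    Σ ℤ λ M → Σ ℤ λ m → Σ ℤ λ t → M ≢ + 0 × (∀ z → Member ℤRing M m t z ⇔ z ∈ L)
  finite-sets-coded L L≢0 = M , product-1+zt t L , t , M≢0 , λ z → only z , coded
    where
    K = bound L
    M = + (K !)
    -- |l| ≤ K for l ∈ L, and |z| ≤ K! for z ∣ M, so |l - z| ≤ W and every nonzero l - z divides W!.
    W = K ℕ.+ K !
    t = + (W !) * + 3
    M≢0 : M ≢ + 0
    M≢0 e = ℕP.m<n⇒n≢0 (ℕP.1≤n! K) (ℤP.+-injective e)
    coded : ∀ {z} → z ∈ L → Member ℤRing M (product-1+zt t L) t z
    coded z∈L = ∣K! _ (L≢0 z∈L) (∈⇒≤bound L z∈L) , ∈⇒1+zt∣product L z∈L
    only : ∀ z → Member ℤRing M (product-1+zt t L) t z → z ∈ L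
    only z (z∣M , d) with z ∈? L
    ... | yes z∈L = z∈L
    ... | no z∉L = ⊥-elim (1+3w∤1 w≢0 (subst (λ v → Divides ℤRing (+ 1 + v) (+ 1))
                     (sym (ℤP.*-assoc z (+ (W !)) (+ 3))) (coprime-to-product L differences d)))
      where
      w≢0 : z * + (W !) ≢ + 0
      w≢0 e = [ (λ { refl → M≢0 (trans (sym (proj₂ z∣M)) (ℤP.*-zeroʳ (proj₁ z∣M))) }) ,
                (λ p → ℕP.m<n⇒n≢0 (ℕP.1≤n! W) (ℤP.+-injective p)) ]′ (ℤP.i*j≡0⇒i≡0∨j≡0 z e)
      differences : ∀ {l} → l ∈ L → Divides ℤRing (l - z) t
      differences {l} l∈L =
        let (q , e) = ∣K! {W} (l - z) (λ p → z∉L (subst (_∈ L) (ℤP.i-j≡0⇒i≡j l z p) l∈L))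
                      (ℕP.≤-trans (ℤP.∣i-j∣≤∣i∣+∣j∣ l z)
                        (ℕP.+-mono-≤ (∈⇒≤bound L l∈L) (Divides⇒≤ M≢0 z∣M)))
        in q * + 3 , trans (swap q (l - z)) (cong (_* + 3) e)
        where
        swap : ∀ q x → q * + 3 * x ≡ q * x * + 3
        swap = solve-∀

-- Evaluation of polynomials at integer points

Poly : ℕ → Set
Poly k = RingStr.Carrier (ℤ[x]^ k)

Point : ℕ → Set
Point k = Fin k → ℤ

module _ where
  open Int using (_+_; _*_; -_; _-_)
  private module A (k : ℕ) = RingStr (ℤ[x]^ k)

  ev : ∀ k → Poly k → Point k → ℤ
  ev zero    n       a = n
  ev (suc k) []      a = + 0
  ev (suc k) (c ∷ p) a = ev k c (tail a) + a zero * ev (suc k) p a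

  ev-ext : ∀ k p {a b} → (∀ i → a i ≡ b i) → ev k p a ≡ ev k p b
  ev-ext zero    p       e = refl
  ev-ext (suc k) []      e = refl
  ev-ext (suc k) (c ∷ p) e =
    cong₂ _+_ (ev-ext k c (λ i → e (suc i))) (cong₂ _*_ (e zero) (ev-ext (suc k) p e))

  ev-0 : ∀ k a → ev k (A.0# k) a ≡ + 0
  ev-0 zero    a = refl
  ev-0 (suc k) a = refl

  ev-+ : ∀ k p q a → ev k (A._+_ k p q) a ≡ ev k p a + ev k q a
  ev-+ zero p q a = refl
  ev-+ (suc k) [] q a = sym (ℤP.+-identityˡ _)
  ev-+ (suc k) (c ∷ p) [] a = sym (ℤP.+-identityʳ _)
  ev-+ (suc k) (c ∷ p) (d ∷ q) a
    rewrite ev-+ k c d (tail a) | ev-+ (suc k) p q a =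
    regroup (ev k c (tail a)) (ev k d (tail a)) (a zero) (ev (suc k) p a) (ev (suc k) q a)
    where
    regroup : ∀ c d x p q → (c + d) + x * (p + q) ≡ (c + x * p) + (d + x * q)
    regroup = solve-∀

  ev-neg : ∀ k p a → ev k (A.-_ k p) a ≡ - ev k p a
  ev-neg zero p a = refl
  ev-neg (suc k) [] a = refl
  ev-neg (suc k) (c ∷ p) a rewrite ev-neg k c (tail a) | ev-neg (suc k) p a =
    regroup (ev k c (tail a)) (a zero) (ev (suc k) p a)
    where
    regroup : ∀ c x p → - c + x * - p ≡ - (c + x * p)
    regroup = solve-∀

  ev-* : ∀ k p q a → ev k (A._*_ k p q) a ≡ ev k p a * ev k q a
  ev-map : ∀ k c q a → ev (suc k) (map (A._*_ k c) q) a ≡ ev k c (tail a) * ev (suc k) q a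

  ev-* zero p q a = refl
  ev-* (suc k) [] q a = sym (ℤP.*-zeroˡ (ev (suc k) q a))
  ev-* (suc k) (c ∷ p) q a
    rewrite ev-+ (suc k) (map (A._*_ k c) q) (A.0# k ∷ A._*_ (suc k) p q) a
          | ev-map k c q a | ev-0 k (tail a) | ev-* (suc k) p q a =
    regroup (ev k c (tail a)) (a zero) (ev (suc k) p a) (ev (suc k) q a)
    where
    regroup : ∀ c x p q → c * q + (+ 0 + x * (p * q)) ≡ (c + x * p) * q
    regroup = solve-∀

  ev-map k c [] a = sym (ℤP.*-zeroʳ (ev k c (tail a)))
  ev-map k c (d ∷ q) a rewrite ev-* k c d (tail a) | ev-map k c q a =
    regroup (ev k c (tail a)) (ev k d (tail a)) (a zero) (ev (suc k) q a)
    where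
    regroup : ∀ c d x q → c * d + x * (c * q) ≡ c * (d + x * q)
    regroup = solve-∀

  ≈⇒ev : ∀ k p q → A._≈_ k p q → ∀ a → ev k p a ≡ ev k q a
  ≈⇒ev zero p q e a = e
  ≈⇒ev (suc k) [] [] e a = refl
  ≈⇒ev (suc k) [] (d ∷ q) (e , f) a =
    trans (trans (sym (ℤP.*-zeroʳ (a zero))) (sym (ℤP.+-identityˡ _)))
          (cong₂ (λ x y → x + a zero * y)
                 (sym (trans (≈⇒ev k d (A.0# k) e (tail a)) (ev-0 k (tail a)))) (≈⇒ev (suc k) [] q f a))
  ≈⇒ev (suc k) (c ∷ p) [] (e , f) a =
    trans (cong₂ (λ x y → x + a zero * y)
                 (trans (≈⇒ev k c (A.0# k) e (tail a)) (ev-0 k (tail a))) (≈⇒ev (suc k) p [] f a))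
          (trans (ℤP.+-identityˡ _) (ℤP.*-zeroʳ (a zero)))
  ≈⇒ev (suc k) (c ∷ p) (d ∷ q) (e , f) a =
    cong₂ (λ x y → x + a zero * y) (≈⇒ev k c d e (tail a)) (≈⇒ev (suc k) p q f a)

  -- Polynomials are determined by their values at integer points

  zero-or-nonvanishing : ∀ k p → A._≈_ k p (A.0# k) ⊎ Σ (Point k) λ a → ev k p a ≢ + 0

  -- Only the first variable moves, so a coefficient list and its tail can share the point a.
  zero-or-eventually-nonvanishing : ∀ k p → A._≈_ (suc k) p [] ⊎
    Σ (Point k) λ a → Σ ℕ λ N → ∀ n → N < n → ev (suc k) p (+ n ∷ᵥ a) ≢ + 0

  zero-or-nonvanishing zero p with p ℤP.≟ + 0
  ... | yes e = inj₁ e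
  ... | no ne = inj₂ ((λ ()) , ne)
  zero-or-nonvanishing (suc k) p with zero-or-eventually-nonvanishing k p
  ... | inj₁ e = inj₁ e
  ... | inj₂ (a , N , h) = inj₂ (+ suc N ∷ᵥ a , h (suc N) (ℕP.n<1+n N))

  zero-or-eventually-nonvanishing k [] = inj₁ tt
  zero-or-eventually-nonvanishing k (c ∷ p)
    with zero-or-nonvanishing k c | zero-or-eventually-nonvanishing k p
  ... | inj₁ e | inj₁ f = inj₁ (e , f)
  ... | inj₂ (a , ne) | inj₁ f = inj₂ (a , 0 , λ n _ e →
    ne (trans (sym (trans (cong (λ v → ev k c a + + n * v) (≈⇒ev (suc k) p [] f _))
                          (trans (cong (λ v → ev k c a + v) (ℤP.*-zeroʳ (+ n))) (ℤP.+-identityʳ _)))) e))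
  -- If c + n·v = 0 with v ≠ 0, then n ≤ |c|; beyond both N and |c| the value cannot vanish.
  ... | _ | inj₂ (a , N , h) = inj₂ (a , N ℕ.+ C , λ n N+C<n e →
    ℕP.<⇒≱ (ℕP.≤-<-trans (ℕP.m≤n+m C N) N+C<n)
      (∣n∣≤ n (ev (suc k) p (+ n ∷ᵥ a)) (h n (ℕP.≤-<-trans (ℕP.m≤m+n N C) N+C<n)) e))
    where
    C = ∣ ev k c a ∣
    ∣n∣≤ : ∀ n v → v ≢ + 0 → ev k c a + + n * v ≡ + 0 → n ≤ C
    ∣n∣≤ n v v≢0 e = ℕP.≤-trans (ℕP.m≤m*n n ∣ v ∣ {{Int.≢-nonZero v≢0}})
      (ℕP.≤-reflexive (trans (sym (ℤP.abs-* (+ n) v))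
        (trans (cong ∣_∣ (trans (solve-for (ev k c a) (+ n * v))
                                (trans (cong (λ v → v - ev k c a) e) (ℤP.+-identityˡ (- ev k c a)))))
               (ℤP.∣-i∣≡∣i∣ (ev k c a)))))
      where
      solve-for : ∀ c w → w ≡ c + w - c
      solve-for = solve-∀

  -- Mutual recursion on the number of variables: coefficients are compared through their values,
  -- with `ev⇒≈` for one variable fewer.
  difference-≈0 : ∀ k p q → A._≈_ k (A._+_ k p (A.-_ k q)) (A.0# k) → A._≈_ k p q
  -- This replaces algebra with coefficient lists: the equations in `ℤ[x]^ k` that follow are mostly
  -- verified pointwise in ℤ.
  ev⇒≈ : ∀ k p q → (∀ a → ev k p a ≡ ev k q a) → A._≈_ k p q

  difference-≈0 zero p q e = ℤP.i-j≡0⇒i≡j p q e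
  difference-≈0 (suc k) [] [] e = tt
  difference-≈0 (suc k) [] (d ∷ q) (e , f) = ev⇒≈ k d (A.0# k) d≡0 , difference-≈0 (suc k) [] q f
    where
    d≡0 : ∀ a → ev k d a ≡ ev k (A.0# k) a
    d≡0 a = ℤP.neg-injective (trans (sym (ev-neg k d a)) (trans (≈⇒ev k _ _ e a)
              (trans (ev-0 k a) (cong -_ (sym (ev-0 k a))))))
  difference-≈0 (suc k) (c ∷ p) [] e = e
  difference-≈0 (suc k) (c ∷ p) (d ∷ q) (e , f) = ev⇒≈ k c d c≡d , difference-≈0 (suc k) p q f
    where
    c≡d : ∀ a → ev k c a ≡ ev k d a
    c≡d a = ℤP.i-j≡0⇒i≡j _ _ (trans (cong (λ v → ev k c a + v) (sym (ev-neg k d a)))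
              (trans (sym (ev-+ k c _ a)) (trans (≈⇒ev k _ _ e a) (ev-0 k a))))

  ev⇒≈ k p q h with zero-or-nonvanishing k (A._+_ k p (A.-_ k q))
  ... | inj₁ e = difference-≈0 k p q e
  ... | inj₂ (a , ne) = ⊥-elim (ne (trans (ev-+ k p _ a)
    (trans (cong (λ v → ev k p a + v) (ev-neg k q a)) (ℤP.i≡j⇒i-j≡0 (h a)))))

  -- Constants, generators, division by a linear factor, and congruences between values

  const : ∀ k → ℤ → Poly k
  const zero    n = n
  const (suc k) n = const k n ∷ []

  ev-const : ∀ k n a → ev k (const k n) a ≡ n
  ev-const zero    n a = refl
  ev-const (suc k) n a =
    trans (cong₂ _+_ (ev-const k n (tail a)) (ℤP.*-zeroʳ (a zero))) (ℤP.+-identityʳ n)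

  ev-[_] : ∀ {k} (p : Poly k) a → ev (suc k) (p ∷ []) a ≡ ev k p (tail a)
  ev-[_] {k} p a = trans (cong (λ v → ev k p (tail a) + v) (ℤP.*-zeroʳ (a zero))) (ℤP.+-identityʳ _)

  generator : ∀ k → Fin k → Poly k
  generator (suc k) zero    = A.0# k ∷ A.1# k ∷ []
  generator (suc k) (suc i) = generator k i ∷ []

  ev-1 : ∀ k a → ev k (A.1# k) a ≡ + 1
  ev-1 zero    a = refl
  ev-1 (suc k) a = trans (ev-[ A.1# k ] a) (ev-1 k (tail a))

  ev-generator : ∀ k i a → ev k (generator k i) a ≡ a i
  ev-generator (suc k) zero a
    rewrite ev-[ A.1# k ] a | ev-0 k (tail a) | ev-1 k (tail a) =
    trans (ℤP.+-identityˡ _) (ℤP.*-identityʳ _)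
  ev-generator (suc k) (suc i) a = trans (ev-[ generator k i ] a) (ev-generator k i (tail a))

  -- Synthetic division by x₀ − n.
  remainder : ∀ k → ℤ → Poly (suc k) → Poly k
  remainder k n []      = A.0# k
  remainder k n (c ∷ p) = A._+_ k c (A._*_ k (const k n) (remainder k n p))

  quotient : ∀ k → ℤ → Poly (suc k) → Poly (suc k)
  quotient k n []      = []
  quotient k n (c ∷ p) = remainder k n p ∷ quotient k n p

  ev-division : ∀ k n p a →
    ev (suc k) p a ≡ ev k (remainder k n p) (tail a) + ev (suc k) (quotient k n p) a * (a zero - n)
  ev-division k n [] a rewrite ev-0 k (tail a) = sym (trans (ℤP.+-identityˡ _) (ℤP.*-zeroˡ (a zero - n)))
  ev-division k n (c ∷ p) a
    rewrite ev-+ k c (A._*_ k (const k n) (remainder k n p)) (tail a)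
          | ev-* k (const k n) (remainder k n p) (tail a) | ev-const k n (tail a)
          | ev-division k n p a =
    regroup (ev k c (tail a)) (a zero) n (ev k (remainder k n p) (tail a)) (ev (suc k) (quotient k n p) a)
    where
    regroup : ∀ c x n r q → c + x * (r + q * (x - n)) ≡ (c + n * r) + (r + x * q) * (x - n)
    regroup = solve-∀

  -- The product rule x·p - y·q = x·(p - q) + (x - y)·q carries the congruence through each Horner
  -- step.
  ev-congruent : ∀ k p d a b → (∀ i → Divides ℤRing d (a i - b i)) →
                 Divides ℤRing d (ev k p a - ev k p b)
  ev-congruent zero p d a b h = + 0 , trans (ℤP.*-zeroˡ d) (sym (ℤP.+-inverseʳ p))
  ev-congruent (suc k) [] d a b h = + 0 , ℤP.*-zeroˡ d
  ev-congruent (suc k) (c ∷ p) d a b h =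
    let (u , e) = ev-congruent k c d (tail a) (tail b) (λ i → h (suc i))
        (v , f) = ev-congruent (suc k) p d a b h
        (w , g) = h zero
    in u + a zero * v + w * ev (suc k) p b ,
       trans (distribute u v w (a zero) (ev (suc k) p b) d)
         (trans (cong₂ _+_ (cong₂ (λ x y → x + a zero * y) e f) (cong (_* ev (suc k) p b) g))
           (regroup (ev k c (tail a)) (ev k c (tail b)) (a zero) (b zero) (ev (suc k) p a) (ev (suc k) p b)))
    where
    distribute : ∀ u v w x y d → (u + x * v + w * y) * d ≡ u * d + x * (v * d) + w * d * y
    distribute = solve-∀
    regroup : ∀ c c′ x y p q → (c - c′) + x * (p - q) + (x - y) * q ≡ (c + x * p) - (c′ + y * q)
    regroup = solve-∀

  multiple-small⇒0 : ∀ d z → ∣ z ∣ < ∣ d ∣ → Divides ℤRing d z → z ≡ + 0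
  multiple-small⇒0 d z z<d z∣d with z ℤP.≟ + 0
  ... | yes e = e
  ... | no ne = ⊥-elim (ℕP.<⇒≱ z<d (IntegerArithmetic.Divides⇒≤ ne z∣d))

  -- With D > 2B, D a is congruent to 0 modulo D and to a modulo D − 1.
  bounded⇒const : ∀ k p B → (∀ a → ∣ ev k p a ∣ ≤ B) → A._≈_ k p (const k (ev k p λ _ → + 0))
  bounded⇒const k p B h = ev⇒≈ k p _ λ a →
    trans (trans (stable (+ suc (B ℕ.+ B)) (s≤s ℕP.≤-refl) a (D· a) (λ i → - a i , shift₁ (a i) (+ (suc (B ℕ.+ B)))))
                 (stable (+ suc (suc (B ℕ.+ B))) (ℕP.m≤n⇒m≤1+n ℕP.≤-refl) (D· a) (λ _ → + 0)
                         (λ i → a i , shift₂ (a i) (+ suc (suc (B ℕ.+ B))))))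
          (sym (ev-const k _ a))
    where
    D· : Point k → Point k
    D· a i = + suc (suc (B ℕ.+ B)) * a i
    shift₁ : ∀ x d → - x * d ≡ x - (+ 1 + d) * x
    shift₁ = solve-∀
    shift₂ : ∀ x d → x * d ≡ d * x - + 0
    shift₂ = solve-∀
    stable : ∀ d → B ℕ.+ B < ∣ d ∣ → ∀ a b → (∀ i → Divides ℤRing d (a i - b i)) → ev k p a ≡ ev k p b
    stable d B+B<d a b c = ℤP.i-j≡0⇒i≡j _ _ (multiple-small⇒0 d _
      (ℕP.≤-<-trans (ℕP.≤-trans (ℤP.∣i-j∣≤∣i∣+∣j∣ (ev k p a) (ev k p b)) (ℕP.+-mono-≤ (h a) (h b))) B+B<d)
      (ev-congruent k p d a b c))

-- The case k = 0 is used for ℤ itself.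
poly-congruence : ∀ k → IsCongruence (ℤ[x]^ k)
poly-congruence k = record
  { ≈-refl  = λ {p} → ev⇒≈ k p p λ a → refl
  ; ≈-sym   = λ {p} {q} e → ev⇒≈ k q p λ a → sym (≈⇒ev k p q e a)
  ; ≈-trans = λ {p} {q} {r} e f → ev⇒≈ k p r λ a → trans (≈⇒ev k p q e a) (≈⇒ev k q r f a)
  ; +-cong  = λ {p} {p′} {q} {q′} e f → ev⇒≈ k _ _ λ a →
      trans (ev-+ k p q a) (trans (cong₂ Int._+_ (≈⇒ev k p p′ e a) (≈⇒ev k q q′ f a)) (sym (ev-+ k p′ q′ a)))
  ; *-cong  = λ {p} {p′} {q} {q′} e f → ev⇒≈ k _ _ λ a →
      trans (ev-* k p q a) (trans (cong₂ Int._*_ (≈⇒ev k p p′ e a) (≈⇒ev k q q′ f a)) (sym (ev-* k p′ q′ a)))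
  ; -‿cong  = λ {p} {p′} e → ev⇒≈ k _ _ λ a →
      trans (ev-neg k p a) (trans (cong Int.-_ (≈⇒ev k p p′ e a)) (sym (ev-neg k p′ a))) }

-- The integers are definable in ℤ[x]^ k

module ConstantsDefinable (k : ℕ) where
  open RingStr (ℤ[x]^ k)
  open Definability (poly-congruence k)
  open IntegerArithmetic using (finite-sets-coded; Divides⇒≤)

  -- A coded set containing c and closed under j ↦ j − 1 except at 1. At a point where M does
  -- not vanish its members take values bounded by that of M, so the descent from c reaches 1.
  Natural : Carrier → Set
  Natural c = Σ Carrier λ M → Σ Carrier λ m → Σ Carrier λ t →
    ¬ (M ≈ 0#) × Member (ℤ[x]^ k) M m t c ×
    (∀ j → Member (ℤ[x]^ k) M m t j → (j ≈ 1#) ⊎ Σ Carrier λ i → ((i + 1#) ≈ j) × Member (ℤ[x]^ k) M m t i)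

  IsInteger : Carrier → Set
  IsInteger c = Σ Carrier λ d → Natural d × Σ Carrier λ e → ((d + c) ≈ e) × Natural e

  memberᵈ : ∀ {n} (M m t z : Fin n) → Def n λ ρ → Member (ℤ[x]^ k) (ρ M) (ρ m) (ρ t) (ρ z)
  memberᵈ M m t z =
    ∃ᵈ (var 0F ⊗ var (suc z) ≈ᵈ var (suc M)) ∧ᵈ
    ∃ᵈ (var 0F ⊗ (𝟙 ⊕ var (suc z) ⊗ var (suc t)) ≈ᵈ var (suc m))

  naturalᵈ : ∀ {n} (c : Fin n) → Def n λ ρ → Natural (ρ c)
  naturalᵈ c = ∃ᵈ (∃ᵈ (∃ᵈ (
    ((var 2F ≈ᵈ 𝟘) ⇒ᵈ ⊥ᵈ) ∧ᵈ
    memberᵈ 2F 1F 0F (suc (suc (suc c))) ∧ᵈ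
    ∀ᵈ (memberᵈ 3F 2F 1F 0F ⇒ᵈ (var 0F ≈ᵈ 𝟙) ∨ᵈ
        ∃ᵈ ((var 0F ⊕ 𝟙 ≈ᵈ var 1F) ∧ᵈ memberᵈ 4F 3F 2F 0F)))))

  isIntegerᵈ : Def 1 λ ρ → IsInteger (ρ 0F)
  isIntegerᵈ = ∃ᵈ (naturalᵈ 0F ∧ᵈ ∃ᵈ ((var 1F ⊕ var 2F ≈ᵈ var 0F) ∧ᵈ naturalᵈ 0F))

  +∣∣-nonneg : ∀ {z B} → ∣ z ∣ ≤ B → Σ ℕ λ n → z Int.+ + B ≡ + n
  +∣∣-nonneg {+ n}      {B} _   = n ℕ.+ B , refl
  +∣∣-nonneg { -[1+ n ]} {B} n<B = B ℕ.∸ suc n , ℤP.⊖-≥ n<B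

  ev-+1 : ∀ {i j} → (i + 1#) ≈ j → ∀ a → ev k i a Int.+ + 1 ≡ ev k j a
  ev-+1 {i} e a = trans (cong (λ v → ev k i a Int.+ v) (sym (ev-1 k a)))
                    (trans (sym (ev-+ k i 1# a)) (≈⇒ev k _ _ e a))

  ev-Divides : ∀ {x y} → Divides (ℤ[x]^ k) x y → ∀ a → Divides ℤRing (ev k x a) (ev k y a)
  ev-Divides {x} (d , e) a = ev k d a , trans (sym (ev-* k d x a)) (≈⇒ev k _ _ e a)

  Natural⇒const : ∀ {c} → Natural c → Σ ℕ λ n → c ≈ const k (+ suc n)
  Natural⇒const {c} (M , m , t , M≢0 , c∈ , step) with zero-or-nonvanishing k M
  ... | inj₁ M≈0 = ⊥-elim (M≢0 M≈0)
  ... | inj₂ (a , Ma≢0) = let (n , e) = offset c∈ in descend n c e c∈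
    where
    B = ∣ ev k M a ∣
    offset : ∀ {j} → Member (ℤ[x]^ k) M m t j → Σ ℕ λ n → ev k j a Int.+ + B ≡ + n
    offset {j} (j∣M , _) = +∣∣-nonneg {ev k j a} (Divides⇒≤ Ma≢0 (ev-Divides j∣M a))
    -- The measure n is the value of j at a, shifted by B so that it is nonnegative for every member
    -- of the coded set.
    descend : ∀ n j → ev k j a Int.+ + B ≡ + n → Member (ℤ[x]^ k) M m t j →
              Σ ℕ λ n → j ≈ const k (+ suc n)
    descend n j e j∈ with step j j∈
    ... | inj₁ j≈1 = 0 , ev⇒≈ k _ _ λ b → trans (≈⇒ev k j 1# j≈1 b) (trans (ev-1 k b) (sym (ev-const k (+ 1) b)))
    ... | inj₂ (i , i+1≈j , i∈) with offset i∈
    -- Passing from j to i = j - 1 lowers the shifted value by exactly one, so n is `suc n′`.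
    ...   | n′ , e′ with trans (sym e) (trans (cong (λ v → v Int.+ + B) (sym (ev-+1 i+1≈j a)))
                           (trans (swap (ev k i a) (+ B)) (cong Int.suc e′)))
      where
      swap : ∀ x y → (x Int.+ + 1) Int.+ y ≡ + 1 Int.+ (x Int.+ y)
      swap = solve-∀
    ...     | refl = let (l , i≈) = descend n′ i e′ i∈ in suc l , ev⇒≈ k _ _ λ b →
      trans (sym (ev-+1 i+1≈j b)) (trans (cong (λ v → v Int.+ + 1) (trans (≈⇒ev k _ _ i≈ b) (ev-const k _ b)))
        (trans (cong +_ (ℕP.+-comm (suc l) 1)) (sym (ev-const k _ b))))

  const-* : ∀ {d z y x} → d Int.* z ≡ y → x ≈ const k z → (const k d * x) ≈ const k y
  const-* {d} {z} {y} {x} e x≈z = ev⇒≈ k _ _ λ a →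
    trans (ev-* k (const k d) x a)
      (trans (cong₂ Int._*_ (ev-const k d a) (trans (≈⇒ev k _ _ x≈z a) (ev-const k z a)))
        (trans e (sym (ev-const k y a))))

  module _ {M m t : ℤ} where

    const-Member : ∀ {z x} → x ≈ const k z → Member ℤRing M m t z →
                   Member (ℤ[x]^ k) (const k M) (const k m) (const k t) x
    const-Member {z} {x} x≈z ((d , e) , (d′ , e′)) =
      (const k d , const-* e x≈z) , (const k d′ , const-* e′ (ev⇒≈ k _ _ λ a →
        trans (ev-1+xt a) (trans (cong (λ v → + 1 Int.+ v Int.* t) (trans (≈⇒ev k _ _ x≈z a) (ev-const k z a)))
          (sym (ev-const k _ a)))))
      where
      ev-1+xt : ∀ a → ev k (1# + (x * const k t)) a ≡ + 1 Int.+ ev k x a Int.* t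
      ev-1+xt a = trans (ev-+ k 1# _ a) (cong₂ Int._+_ (ev-1 k a)
                    (trans (ev-* k x _ a) (cong (λ v → ev k x a Int.* v) (ev-const k t a))))

    -- At each integer point a divisor of the constant M ≠ 0 is bounded by |M|, hence it is constant
    -- by `bounded⇒const`. A set coded by constants thus gains no new members in the larger ring.
    Member-const : M ≢ + 0 → ∀ {x} → Member (ℤ[x]^ k) (const k M) (const k m) (const k t) x →
                   Σ ℤ λ z → x ≈ const k z × Member ℤRing M m t z
    Member-const M≢0 {x} (x∣M , 1+xt∣m) =
      ev k x (λ _ → + 0) ,
      bounded⇒const k x ∣ M ∣ (λ a → Divides⇒≤ M≢0 (subst (Divides ℤRing _) (ev-const k M a) (ev-Divides x∣M a))) ,
      subst (Divides ℤRing _) (ev-const k M _) (ev-Divides x∣M _) ,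
      subst (λ v → Divides ℤRing v m) ev-1+xt (subst (Divides ℤRing _) (ev-const k m _) (ev-Divides 1+xt∣m _))
      where
      ev-1+xt : ev k (1# + (x * const k t)) (λ _ → + 0) ≡ + 1 Int.+ ev k x (λ _ → + 0) Int.* t
      ev-1+xt = trans (ev-+ k 1# _ _) (cong₂ Int._+_ (ev-1 k _)
                  (trans (ev-* k x _ _) (cong (λ v → ev k x _ Int.* v) (ev-const k t _))))

  -- The descent ends at 1 and not at 0, because 0 does not divide a nonzero `M`.
  positives : ℕ → List ℤ
  positives zero    = []
  positives (suc n) = + suc n ∷ positives n

  ∈-positives : ∀ n {z} → z ∈ positives n →
                z ≡ + 1 ⊎ Σ ℕ λ i → z ≡ + suc (suc i) × + suc i ∈ positives n
  ∈-positives (suc zero)    (here e) = inj₁ e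
  ∈-positives (suc (suc n)) (here e) = inj₂ (n , e , there (here refl))
  ∈-positives (suc n) (there z∈) with ∈-positives n z∈
  ... | inj₁ e = inj₁ e
  ... | inj₂ (i , e , i∈) = inj₂ (i , e , there i∈)

  positives≢0 : ∀ n {z} → z ∈ positives n → z ≢ + 0
  positives≢0 (suc n) (here refl) ()
  positives≢0 (suc n) (there z∈) e = positives≢0 n z∈ e

  const⇒Natural : ∀ {c} n → c ≈ const k (+ suc n) → Natural c
  const⇒Natural n c≈ with finite-sets-coded (positives (suc n)) (positives≢0 (suc n))
  ... | M , m , t , M≢0 , code = const k M , const k m , const k t , M≉0 ,
        const-Member c≈ (proj₂ (code _) (here refl)) , step
    where
    M≉0 : ¬ (const k M ≈ 0#)
    M≉0 e = M≢0 (trans (sym (ev-const k M λ _ → + 0)) (trans (≈⇒ev k _ _ e _) (ev-0 k _)))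
    step : ∀ j → Member (ℤ[x]^ k) (const k M) (const k m) (const k t) j →
           (j ≈ 1#) ⊎ Σ Carrier λ i → ((i + 1#) ≈ j) × Member (ℤ[x]^ k) (const k M) (const k m) (const k t) i
    step j j∈ with Member-const M≢0 j∈
    ... | z , j≈z , z∈ with ∈-positives (suc n) (proj₁ (code z) z∈)
    ...   | inj₁ refl = inj₁ (ev⇒≈ k _ _ λ a →
            trans (≈⇒ev k _ _ j≈z a) (trans (ev-const k _ a) (sym (ev-1 k a))))
    ...   | inj₂ (i , refl , i∈) = inj₂ (const k (+ suc i) ,
            (ev⇒≈ k _ _ λ a → trans (ev-+ k _ 1# a)
              (trans (cong₂ Int._+_ (ev-const k (+ suc i) a) (ev-1 k a))
                (trans (cong +_ (ℕP.+-comm (suc i) 1)) (sym (trans (≈⇒ev k _ _ j≈z a) (ev-const k _ a)))))) ,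
            const-Member (IsCongruence.≈-refl (poly-congruence k)) (proj₂ (code _) i∈))

  IsInteger⇔const : ∀ c → IsInteger c ⇔ Σ ℤ λ z → c ≈ const k z
  IsInteger⇔const c = to , from
    where
    to : IsInteger c → Σ ℤ λ z → c ≈ const k z
    to (d , d∈ , e , d+c≈e , e∈) =
      let (n , d≈) = Natural⇒const d∈
          (m , e≈) = Natural⇒const e∈
      in + suc m Int.- + suc n , ev⇒≈ k _ _ λ a →
        trans (solve-for (ev k d a) (ev k c a))
          (trans (cong₂ Int._-_ (trans (sym (ev-+ k d c a)) (trans (≈⇒ev k _ _ d+c≈e a)
                                   (trans (≈⇒ev k _ _ e≈ a) (ev-const k _ a))))
                                (trans (≈⇒ev k _ _ d≈ a) (ev-const k _ a)))
            (sym (ev-const k _ a)))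
      where
      solve-for : ∀ x y → y ≡ (x Int.+ y) Int.- x
      solve-for = solve-∀
    from : (Σ ℤ λ z → c ≈ const k z) → IsInteger c
    from (z , c≈z) =
      let (n , e) = +∣∣-nonneg {z} ℕP.≤-refl
          ≈-refl = IsCongruence.≈-refl (poly-congruence k)
      -- z = (z + |z| + 1) - (|z| + 1), a difference of positive integers.
      in const k (+ suc ∣ z ∣) , const⇒Natural ∣ z ∣ ≈-refl , _ , ≈-refl ,
         const⇒Natural n (ev⇒≈ k _ _ λ a → trans (ev-+ k _ c a)
           (trans (cong₂ Int._+_ (ev-const k _ a) (trans (≈⇒ev k _ _ c≈z a) (ev-const k z a)))
             (trans (shift z (+ ∣ z ∣)) (trans (cong Int.suc e) (sym (ev-const k _ a))))))
      where
      shift : ∀ x y → (+ 1 Int.+ y) Int.+ x ≡ + 1 Int.+ (x Int.+ y)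
      shift = solve-∀

-- Polynomials coded by integers

module IntegerCodes where
  open Int using (_+_; _*_)
  open IntegerArithmetic
  open Definability (poly-congruence 0)
  open ConstantsDefinable 0 using (memberᵈ)

  -- What is coded is the coefficient list, trailing zeros included. A polynomial in at least one
  -- variable has many codes, and equality of polynomials becomes the relation for `eqᵒ` on codes.
  enc : ∀ k → Poly k → ℤ
  enc zero    n       = n
  enc (suc k) []      = + 0
  enc (suc k) (c ∷ p) = pair (enc k c) (enc (suc k) p)

  enc-injective : ∀ k p q → enc k p ≡ enc k q → p ≡ q
  enc-injective zero    p q e = e
  enc-injective (suc k) [] [] e = refl
  enc-injective (suc k) [] (d ∷ q) e = contradiction (sym e) (pair≢0 (enc k d) (enc (suc k) q))
  enc-injective (suc k) (c ∷ p) [] e = contradiction e (pair≢0 (enc k c) (enc (suc k) p))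
  enc-injective (suc k) (c ∷ p) (d ∷ q) e =
    let (f , g) = pair-injective (enc k c) (enc (suc k) p) (enc k d) (enc (suc k) q) e
    in cong₂ _∷_ (enc-injective k c d f) (enc-injective (suc k) p q g)

  Value : ∀ k → (u c : ℤ) → Point k → Set
  Value k u c a = Σ (Poly k) λ p → enc k p ≡ u × ev k p a ≡ c

  Value-ext : ∀ {k u c a b} → (∀ i → a i ≡ b i) → Value k u c a → Value k u c b
  Value-ext {k} e (p , f , g) = p , f , trans (sym (ev-ext k p e)) g

  -- A Horner evaluation of the polynomial coded by u: a coded set of pairs (code, value).
  Trace : ∀ k → (u c : ℤ) → Point (suc k) → Set
  Trace k u c a = Σ ℤ λ M → Σ ℤ λ m → Σ ℤ λ t →
    (Σ ℤ λ s → s ≡ pair u c × Member ℤRing M m t s) ×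
    (∀ v h s → s ≡ pair v h → Member ℤRing M m t s →
      (v ≡ + 0 × h ≡ + 0) ⊎
      Σ ℤ λ e → Σ ℤ λ w → Σ ℤ λ g → Σ ℤ λ l →
        v ≡ pair e w × Value k e g (tail a) × h ≡ g + a zero * l ×
        Σ ℤ λ r → r ≡ pair w l × Member ℤRing M m t r)

  -- Termination comes from the size of the code v, which drops at each Horner step. The descent
  -- also builds the polynomial, so `Trace` expresses that u is a code at all.
  Trace⇒Value : ∀ {k u c a} → Trace k u c a → Value (suc k) u c a
  Trace⇒Value {k} {u} {c} {a} (M , m , t , (s , s≡ , s∈) , step) =
    descend (suc ∣ u ∣) u c s (ℕP.n<1+n _) s≡ s∈
    where
    descend : ∀ n v h s → ∣ v ∣ < n → s ≡ pair v h → Member ℤRing M m t s → Value (suc k) v h a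
    descend (suc n) v h s (s≤s v≤n) s≡ s∈ with step v h s s≡ s∈
    ... | inj₁ (refl , refl) = [] , refl , refl
    ... | inj₂ (e , w , g , l , refl , (d , refl , refl) , refl , r , r≡ , r∈)
      with descend n w l r (ℕP.<-≤-trans (∣y∣<∣pair∣ e w) v≤n) r≡ r∈
    ...   | p , refl , refl = d ∷ p , refl , refl

  module _ (k : ℕ) (a : Point (suc k)) where
    state : Poly (suc k) → ℤ
    state p = pair (enc (suc k) p) (ev (suc k) p a)

    trace : Poly (suc k) → List ℤ
    trace []      = state [] ∷ []
    trace (c ∷ p) = state (c ∷ p) ∷ trace p

    state∈trace : ∀ p → state p ∈ trace p
    state∈trace []      = here refl
    state∈trace (c ∷ p) = here refl

    trace≢0 : ∀ p {z} → z ∈ trace p → z ≢ + 0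
    trace≢0 [] (here refl) = pair≢0 (+ 0) (+ 0)
    trace≢0 (c ∷ p) (here refl) = pair≢0 (enc (suc k) (c ∷ p)) (ev (suc k) (c ∷ p) a)
    trace≢0 (c ∷ p) (there z∈) = trace≢0 p z∈

    ∈-trace : ∀ p {z} → z ∈ trace p → z ≡ state [] ⊎
              Σ (Poly k) λ c → Σ (Poly (suc k)) λ q → z ≡ state (c ∷ q) × state q ∈ trace p
    ∈-trace [] (here e) = inj₁ e
    ∈-trace (c ∷ p) (here e) = inj₂ (c , p , e , there (state∈trace p))
    ∈-trace (c ∷ p) (there z∈) with ∈-trace p z∈
    ... | inj₁ e = inj₁ e
    ... | inj₂ (d , q , e , q∈) = inj₂ (d , q , e , there q∈)

  Value⇒Trace : ∀ {k u c a} → Value (suc k) u c a → Trace k u c a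
  Value⇒Trace {k} {u} {c} {a} (p , refl , refl) with finite-sets-coded (trace k a p) (trace≢0 k a p)
  ... | M , m , t , _ , code = M , m , t , (_ , refl , proj₂ (code _) (state∈trace k a p)) , step
    where
    step : ∀ v h s → s ≡ pair v h → Member ℤRing M m t s →
      (v ≡ + 0 × h ≡ + 0) ⊎
      Σ ℤ λ e → Σ ℤ λ w → Σ ℤ λ g → Σ ℤ λ l →
        v ≡ pair e w × Value k e g (tail a) × h ≡ g + a zero * l ×
        Σ ℤ λ r → r ≡ pair w l × Member ℤRing M m t r
    step v h s refl s∈ with ∈-trace k a p (proj₁ (code s) s∈)
    ... | inj₁ e = inj₁ (pair-injective v h (+ 0) (+ 0) e)
    ... | inj₂ (d , q , e , q∈)
      with pair-injective v h (enc (suc k) (d ∷ q)) (ev (suc k) (d ∷ q) a) e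
    ...   | refl , refl = inj₂ (enc k d , enc (suc k) q , ev k d (tail a) , ev (suc k) q a ,
              refl , (d , refl , refl) , refl , _ , refl , proj₂ (code _) q∈)

  opaque
    unfolding pair

    pairᵈ : ∀ {n} (s x y : Fin n) → Def n λ ρ → ρ s ≡ pair (ρ x) (ρ y)
    pairᵈ s x y = var s ≈ᵈ (f x ⊕ f y) ⊗ (f x ⊕ f y) ⊕ f x ⊕ 𝟙
      where
      f : ∀ {n} → Fin n → Term n
      f x = var x ⊗ var x ⊕ var x ⊗ var x ⊕ var x

  opaque
    valueᵈ : ∀ k {n} (u c : Fin n) (a : Fin k → Fin n) → Def n λ ρ → Value k (ρ u) (ρ c) λ i → ρ (a i)
    valueᵈ zero u c a = def-resp
      (λ ρ → (λ e → ρ u , refl , e) , (λ { (_ , e , f) → trans (sym e) f })) (var u ≈ᵈ var c)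
    valueᵈ (suc k) {n} u c a = def-resp (λ ρ → Trace⇒Value , Value⇒Trace) traceᵈ
      where
      traceᵈ : Def n λ ρ → Trace k (ρ u) (ρ c) λ i → ρ (a i)
      traceᵈ = ∃ᵈ (∃ᵈ (∃ᵈ (
        ∃ᵈ (pairᵈ 0F (4↑ u) (4↑ c) ∧ᵈ memberᵈ 3F 2F 1F 0F) ∧ᵈ
        ∀ᵈ (∀ᵈ (∀ᵈ (pairᵈ 0F 2F 1F ⇒ᵈ memberᵈ 5F 4F 3F 0F ⇒ᵈ
          ((var 2F ≈ᵈ 𝟘) ∧ᵈ (var 1F ≈ᵈ 𝟘)) ∨ᵈ
          -- Under these four quantifiers the variables 0 to 9 are l, g, w, e, s, h, v, t, m, M.
          ∃ᵈ (∃ᵈ (∃ᵈ (∃ᵈ (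
            pairᵈ 6F 3F 2F ∧ᵈ
            valueᵈ k 3F 1F (λ i → 10↑ (a (suc i))) ∧ᵈ
            (var 5F ≈ᵈ var 1F ⊕ var (10↑ (a zero)) ⊗ var 0F) ∧ᵈ
            ∃ᵈ (pairᵈ 0F 3F 1F ∧ᵈ memberᵈ (suc 9F) 9F 8F 0F)))))))))))
        where
        4↑ : Fin n → Fin (4 ℕ.+ n)
        4↑ i = suc (suc (suc (suc i)))
        10↑ : Fin n → Fin (10 ℕ.+ n)
        10↑ i = suc (suc (suc (suc (suc (suc (suc (suc (suc (suc i)))))))))

-- The interpretation of ℤ[x]^ k in ℤ

data Op : Set where
  eqᵒ addᵒ mulᵒ negᵒ zerᵒ oneᵒ : Op

atom : Op → Formula 3
atom eqᵒ  = 0F ≐ 1F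
atom addᵒ = plus 0F 1F 2F
atom mulᵒ = times 0F 1F 2F
atom negᵒ = minus 0F 1F
atom zerᵒ = isZero 0F
atom oneᵒ = isOne 0F

-- Every atom is an equation between ring terms; evaluation at a point is a homomorphism, and `ev⇒≈`
-- returns from the values to the polynomials.
atom-pointwise : ∀ k o p q r →
  (∀ a → Sat (graph ℤRing) (atom o) ⟨ ev k p a , ev k q a , ev k r a ⟩) ⇔
  Sat (graph (ℤ[x]^ k)) (atom o) ⟨ p , q , r ⟩
atom-pointwise k eqᵒ p q r = ev⇒≈ k p q , ≈⇒ev k p q
atom-pointwise k addᵒ p q r =
  (λ h → ev⇒≈ k _ r λ a → trans (ev-+ k p q a) (h a)) ,
  (λ e a → trans (sym (ev-+ k p q a)) (≈⇒ev k _ r e a))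
atom-pointwise k mulᵒ p q r =
  (λ h → ev⇒≈ k _ r λ a → trans (ev-* k p q a) (h a)) ,
  (λ e a → trans (sym (ev-* k p q a)) (≈⇒ev k _ r e a))
atom-pointwise k negᵒ p q r =
  (λ h → ev⇒≈ k _ q λ a → trans (ev-neg k p a) (h a)) ,
  (λ e a → trans (sym (ev-neg k p a)) (≈⇒ev k _ q e a))
atom-pointwise k zerᵒ p q r =
  (λ h → ev⇒≈ k p _ λ a → trans (h a) (sym (ev-0 k a))) ,
  (λ e a → trans (≈⇒ev k p _ e a) (ev-0 k a))
atom-pointwise k oneᵒ p q r =
  (λ h → ev⇒≈ k p _ λ a → trans (h a) (sym (ev-1 k a))) ,
  (λ e a → trans (≈⇒ev k p _ e a) (ev-1 k a))

module PolynomialInterpretation (k : ℕ) where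
  open IntegerCodes
  open Definability (poly-congruence 0)

  Pointwise : Op → (u v w : ℤ) → Set
  Pointwise o u v w = ∀ a x y z → Value k u x a → Value k v y a → Value k w z a →
                      Sat (graph ℤRing) (atom o) ⟨ x , y , z ⟩

  opaque
    pointwiseᵈ : ∀ o → Def 3 λ ρ → Pointwise o (ρ 0F) (ρ 1F) (ρ 2F)
    pointwiseᵈ o = tuple-∀ᵈ k
      (λ e h x y z p q r → h x y z (Value-ext (λ i → sym (e i)) p) (Value-ext (λ i → sym (e i)) q)
                                   (Value-ext (λ i → sym (e i)) r))
      (∀ᵈ (∀ᵈ (∀ᵈ (
        valueᵈ k (3↑ (k ↑ʳ 0F)) 2F (λ i → 3↑ (i ↑ˡ 3)) ⇒ᵈ
        valueᵈ k (3↑ (k ↑ʳ 1F)) 1F (λ i → 3↑ (i ↑ˡ 3)) ⇒ᵈ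
        valueᵈ k (3↑ (k ↑ʳ 2F)) 0F (λ i → 3↑ (i ↑ˡ 3)) ⇒ᵈ
        ternaryᵈ (atom o) 2F 1F 0F))))
      where
      3↑ : ∀ {n} → Fin n → Fin (3 ℕ.+ n)
      3↑ i = suc (suc (suc i))

  Sat-pointwise : ∀ o {u v w p q r} → enc k p ≡ u → enc k q ≡ v → enc k r ≡ w →
    Sat (graph ℤRing) (formula (pointwiseᵈ o)) ⟨ u , v , w ⟩ ⇔ Sat (graph (ℤ[x]^ k)) (atom o) ⟨ p , q , r ⟩
  Sat-pointwise o {u} {v} {w} {p} {q} {r} e f g =
    correct (pointwiseᵈ o) _ ⇔∘ to-values ⇔∘ atom-pointwise k o p q r
    where
    value-unique : ∀ {s p a x} → enc k p ≡ s → Value k s x a → x ≡ ev k p a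
    value-unique {p = p} e (p′ , e′ , refl) = cong (λ t → ev k t _) (enc-injective k p′ p (trans e′ (sym e)))
    to-values : Pointwise o u v w ⇔
                (∀ a → Sat (graph ℤRing) (atom o) ⟨ ev k p a , ev k q a , ev k r a ⟩)
    to-values =
      (λ h a → h a _ _ _ (p , e , refl) (q , f , refl) (r , g , refl)) ,
      (λ h a x y z P Q R → subst (Sat (graph ℤRing) (atom o))
        (sym (cong₂ (λ x (y , z) → ⟨ x , y , z ⟩) (value-unique e P) (cong₂ _,_ (value-unique f Q) (value-unique g R))))
        (h a))

  operation : ∀ {n} → Op → (u v w : Fin n) → Formula n
  operation o u v w = rename ⟨ u , v , w ⟩ (formula (pointwiseᵈ o))

  Sat-operation : ∀ S {n} o (u v w : Fin n) {ρ} →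
    Sat S (operation o u v w) ρ ⇔ Sat S (formula (pointwiseᵈ o)) ⟨ ρ u , ρ v , ρ w ⟩
  Sat-operation S o u v w =
    Sat-rename S _ (formula (pointwiseᵈ o)) λ { 0F → refl ; 1F → refl ; 2F → refl }

  -- The evaluation point plays no role here.
  codeᵈ : Def 1 λ ρ → Σ ℤ λ c → Value k (ρ 0F) c λ _ → ρ 0F
  codeᵈ = ∃ᵈ (valueᵈ k 1F 0F λ _ → 1F)

  isCode : ∀ {n} → Formula (suc n)
  isCode = rename (λ _ → zero) (formula codeᵈ)

  Sat-isCode : ∀ {n} (ρ : Fin (suc n) → ℤ) → Sat (graph ℤRing) isCode ρ ⇔ Σ (Poly k) λ p → enc k p ≡ ρ zero
  Sat-isCode ρ = Sat-rename _ _ (formula codeᵈ) (λ _ → refl) ⇔∘ correct codeᵈ _ ⇔∘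
    (λ (c , p , e , _) → p , e) , (λ (p , e) → _ , p , e , refl)

  polynomials : Code 1 0
  polynomials = record
    { dom = isCode
    ; eqv = operation eqᵒ 0F 1F 1F
    ; add = operation addᵒ 0F 1F 2F
    ; mul = operation mulᵒ 0F 1F 2F
    ; neg = operation negᵒ 0F 1F 1F
    ; zer = operation zerᵒ 0F 0F 0F
    ; one = operation oneᵒ 0F 0F 0F }

  module _ (ps : Fin 0 → ℤ) where

    -- Satisfaction is proof-relevant, so the polynomial is read off from the proof that u is a
    -- code; by `enc-injective` it depends on the code alone.
    decode : Dom (Interp (graph ℤRing) polynomials ps) → Poly k
    decode (u , s) = proj₁ (proj₁ (Sat-isCode _) s)

    enc-decode : ∀ u → enc k (decode u) ≡ proj₁ u zero
    enc-decode (u , s) = proj₂ (proj₁ (Sat-isCode _) s)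

    code : Poly k → Dom (Interp (graph ℤRing) polynomials ps)
    code p = (λ _ → enc k p) , proj₂ (Sat-isCode _) (p , refl)

    decode-code : ∀ p → decode (code p) ≡ p
    decode-code p = enc-injective k _ p (enc-decode (code p))

    Sat-operation-decode : ∀ o {n} (i j l : Fin n) {ρ} u v w →
      proj₁ u zero ≡ ρ i → proj₁ v zero ≡ ρ j → proj₁ w zero ≡ ρ l →
      Sat (graph ℤRing) (operation o i j l) ρ ⇔
      Sat (graph (ℤ[x]^ k)) (atom o) ⟨ decode u , decode v , decode w ⟩
    Sat-operation-decode o i j l u v w e f g = Sat-operation _ o i j l ⇔∘
      Sat-pointwise o (trans (enc-decode u) e) (trans (enc-decode v) f) (trans (enc-decode w) g)

    decode-coordinate : IsCoordMap (Interp (graph ℤRing) polynomials ps) (ℤ[x]^ k) decode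
    decode-coordinate = record
      { surj = λ p → code p , ≡⇒≈ (decode-code p)
      ; eq  = λ u v → Sat-operation-decode eqᵒ 0F 1F 1F u v v refl refl refl
      ; add = λ u v w → Sat-operation-decode addᵒ 0F 1F 2F u v w refl refl refl
      ; mul = λ u v w → Sat-operation-decode mulᵒ 0F 1F 2F u v w refl refl refl
      ; neg = λ u v → Sat-operation-decode negᵒ 0F 1F 1F u v v refl refl refl
      ; zer = λ u → Sat-operation-decode zerᵒ 0F 0F 0F u u u refl refl refl
      ; one = λ u → Sat-operation-decode oneᵒ 0F 0F 0F u u u refl refl refl }
      where
      ≡⇒≈ : ∀ {p q} → p ≡ q → RingStr._≈_ (ℤ[x]^ k) p q
      ≡⇒≈ refl = IsCongruence.≈-refl (poly-congruence k)

-- The interpretation of ℤ in ℤ[x]^ k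

module IntegerInterpretation (k : ℕ) where
  open RingStr (ℤ[x]^ k)
  open IsCongruence (poly-congruence k)
  open Definability (poly-congruence k)
  open ConstantsDefinable k

  opaque
    integer : Formula 1
    integer = formula isIntegerᵈ

    Sat-integer : ∀ x → Sat (graph (ℤ[x]^ k)) integer (λ _ → x) ⇔ Σ ℤ λ z → x ≈ const k z
    Sat-integer x = correct isIntegerᵈ (λ _ → x) ⇔∘ IsInteger⇔const x

  integers : Code 1 k
  integers = inducedCode integer k

  const-injective : ∀ {m n} → const k m ≈ const k n → m ≡ n
  const-injective e = trans (sym (ev-const k _ λ _ → + 0)) (trans (≈⇒ev k _ _ e _) (ev-const k _ _))

  Sat-atom-const : ∀ o x y z → Sat (graph (ℤ[x]^ k)) (atom o) ⟨ const k x , const k y , const k z ⟩ ⇔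
                               Sat (graph ℤRing) (atom o) ⟨ x , y , z ⟩
  Sat-atom-const o x y z = ⇔-sym (atom-pointwise k o _ _ _) ⇔∘
    (λ h → proj₁ (at λ _ → + 0) (h _)) , (λ s a → proj₂ (at a) s)
    where
    at : ∀ a → Sat (graph ℤRing) (atom o) ⟨ ev k (const k x) a , ev k (const k y) a , ev k (const k z) a ⟩ ⇔
               Sat (graph ℤRing) (atom o) ⟨ x , y , z ⟩
    at a = Sat-resp (poly-congruence 0) (atom o)
      λ { 0F → ev-const k x a ; 1F → ev-const k y a ; 2F → ev-const k z a }

  -- Taking the identity for f gives the interpretation of ℤ in `ℤ[x]^ k`; taking
  -- `decode-coordinate` gives the composite interpretation of ℤ in itself.
  module _ {S : RelStr} {f : Dom S → Carrier} (coord : IsCoordMap S (ℤ[x]^ k) f) (ps : Fin k → Dom S) where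

    Sat-domain-integer : ∀ (u : Fin 1 → Dom S) → Sat S (domain integer) (u ++ ps) ⇔
                        Σ ℤ λ z → f (u zero) ≈ const k z
    Sat-domain-integer u =
      Sat-transfer (poly-congruence k) coord (domain integer) {ρ = u ++ ps} {ρ′ = λ i → f ((u ++ ps) i)} (λ _ → ≈-refl) ⇔∘
      Sat-domain integer (λ i → f ((u ++ ps) i)) refl ⇔∘ Sat-integer (f (u zero))

    value : Dom (Interp S integers ps) → ℤ
    value (u , s) = proj₁ (proj₁ (Sat-domain-integer u) s)

    const-value : ∀ u → f (proj₁ u zero) ≈ const k (value u)
    const-value (u , s) = proj₂ (proj₁ (Sat-domain-integer u) s)

    Sat-atom-value : ∀ o u v w → Sat S (atom o) ⟨ proj₁ u zero , proj₁ v zero , proj₁ w zero ⟩ ⇔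
                                 Sat (graph ℤRing) (atom o) ⟨ value u , value v , value w ⟩
    Sat-atom-value o u v w = Sat-transfer (poly-congruence k) coord (atom o)
      (λ { 0F → const-value u ; 1F → const-value v ; 2F → const-value w }) ⇔∘ Sat-atom-const o _ _ _

    value-coordinate : IsCoordMap (Interp S integers ps) ℤRing value
    value-coordinate = record
      { surj = λ n →
          let (x , e) = IsCoordMap.surj coord (const k n)
              u = (λ _ → x) , proj₂ (Sat-domain-integer λ _ → x) (n , e)
          in u , const-injective (≈-trans (≈-sym (const-value u)) e)
      ; eq  = λ u v → Sat-atom-value eqᵒ u v v
      ; add = λ u v w → Sat-atom-value addᵒ u v w
      ; mul = λ u v w → Sat-atom-value mulᵒ u v w
      ; neg = λ u v → Sat-atom-value negᵒ u v v
      ; zer = λ u → Sat-atom-value zerᵒ u u u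
      ; one = λ u → Sat-atom-value oneᵒ u u u }

  -- The bridge between the two rings: everything defined arithmetically over ℤ can be said inside
  -- `ℤ[x]^ k` about the constants.
  Sat-relativise-const : ∀ {n} (φ : Formula n) {ρ z} → (∀ i → ρ i ≈ const k (z i)) →
                         Sat (graph (ℤ[x]^ k)) (relativise integer φ) ρ ⇔ Sat (graph ℤRing) φ z
  Sat-relativise-const φ {ρ} {z} e =
    ⇔-sym (Sat-relativise integer {qs = generator k} φ {ρ = ρ̂} λ _ → refl) ⇔∘
    Sat-transfer (poly-congruence 0) (value-coordinate id-coord (generator k)) φ
      λ i → const-injective (≈-trans (≈-sym (const-value id-coord (generator k) (ρ̂ i))) (e i))
    where
    id-coord : IsCoordMap (graph (ℤ[x]^ k)) (ℤ[x]^ k) λ a → a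
    id-coord = identity-coordinate (poly-congruence k)
    ρ̂ : ∀ i → Dom (Interp (graph (ℤ[x]^ k)) integers (generator k))
    ρ̂ i = (λ _ → ρ i) , proj₂ (Sat-domain-integer id-coord (generator k) λ _ → ρ i) (z i , e i)

-- Congruence of polynomials modulo the ideal generated by the differences y i − a i

module _ (k : ℕ) where
  open RingStr (ℤ[x]^ k)

  Congruent : ∀ {j} → (y a : Fin j → Carrier) → Carrier → Carrier → Set
  Congruent {zero}  y a x c = x ≈ c
  Congruent {suc j} y a x c = Σ Carrier λ s → Σ Carrier λ r →
    (x ≈ (r + (s * (y zero + (- a zero))))) × Congruent (tail y) (tail a) r c

ev-step : ∀ k r s y c a → let open RingStr (ℤ[x]^ k) in
  ev k (r + (s * (y + (- c)))) a ≡ ev k r a Int.+ ev k s a Int.* (ev k y a Int.- ev k c a)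
ev-step k r s y c a = trans (ev-+ k r _ a) (cong (λ v → ev k r a Int.+ v) (trans (ev-* k s _ a)
  (cong (λ v → ev k s a Int.* v) (trans (ev-+ k y _ a) (cong (λ v → ev k y a Int.+ v) (ev-neg k c a))))))

module _ {k : ℕ} where
  open RingStr (ℤ[x]^ k)
  open IsCongruence (poly-congruence k)

  Congruent-resp : ∀ {j} {y a b : Fin j → Carrier} {x c} → (∀ i → a i ≈ b i) →
                   Congruent k y a x c → Congruent k y b x c
  Congruent-resp {zero} e h = h
  Congruent-resp {suc j} e (s , r , f , h) =
    s , r , ≈-trans f (+-cong ≈-refl (*-cong ≈-refl (+-cong ≈-refl (-‿cong (e zero))))) ,
    Congruent-resp (λ i → e (suc i)) h

  Congruent⇒ev : ∀ {j} {y a : Fin j → Carrier} {x c} z → (∀ i → ev k (y i) z ≡ ev k (a i) z) →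
                 Congruent k y a x c → ev k x z ≡ ev k c z
  Congruent⇒ev {zero} z e h = ≈⇒ev k _ _ h z
  Congruent⇒ev {suc j} {y} {a} {x} z e (s , r , f , h) =
    trans (≈⇒ev k x _ f z) (trans (ev-step k r s (y zero) (a zero) z)
      (trans (cong (λ v → ev k r z Int.+ ev k s z Int.* v) (ℤP.i≡j⇒i-j≡0 (e zero)))
        (trans (cong (λ v → ev k r z Int.+ v) (ℤP.*-zeroʳ (ev k s z)))
          (trans (ℤP.+-identityʳ _) (Congruent⇒ev z (λ i → e (suc i)) h)))))

  -- For the induction on k: after division by the first linear factor, the remainder and the other
  -- generators come from the coefficient ring.
  Congruent-embed : ∀ {j} {y a : Fin j → Carrier} {x c} → Congruent k y a x c →
                    Congruent (suc k) (λ i → y i ∷ []) (λ i → a i ∷ []) (x ∷ []) (c ∷ [])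
  Congruent-embed {zero} h = h , tt
  Congruent-embed {suc j} {y} {a} {x} (s , r , f , h) =
    s ∷ [] , r ∷ [] , ev⇒≈ (suc k) (x ∷ []) rhs embedded , Congruent-embed {j} {tail y} {tail a} h
    where
    module B = RingStr (ℤ[x]^ (suc k))
    rhs : Poly (suc k)
    rhs = (r ∷ []) B.+ ((s ∷ []) B.* ((y zero ∷ []) B.+ (B.- (a zero ∷ []))))
    embedded : ∀ b → ev (suc k) (x ∷ []) b ≡ ev (suc k) rhs b
    embedded b = trans (trans (ev-[ x ] b) (≈⇒ev k x _ f (tail b)))
      (trans (trans (ev-step k r s (y zero) (a zero) (tail b))
        (sym (cong₂ Int._+_ (ev-[ r ] b) (cong₂ Int._*_ (ev-[ s ] b)
          (cong₂ Int._-_ (ev-[ y zero ] b) (ev-[ a zero ] b))))))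
        (sym (ev-step (suc k) (r ∷ []) (s ∷ []) (y zero ∷ []) (a zero ∷ []) b)))

-- The remainder theorem, iterated: dividing by x₀ - z₀ leaves a remainder free of x₀, and the last
-- remainder is the value at z.
Congruent-value : ∀ k x z → Congruent k (generator k) (λ i → const k (z i)) x (const k (ev k x z))
Congruent-value zero x z = refl
Congruent-value (suc k) x z =
  quotient k (z zero) x , remainder k (z zero) x ∷ [] , ev⇒≈ (suc k) x _ division ,
  subst (λ v → Congruent (suc k) (λ i → generator k i ∷ []) (λ i → const k (z (suc i)) ∷ []) (r ∷ []) (const k v ∷ []))
    (sym at-z) (Congruent-embed {y = generator k} {a = λ i → const k (z (suc i))} (Congruent-value k r (tail z)))
  where
  open RingStr (ℤ[x]^ (suc k))
  r = remainder k (z zero) x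
  q = quotient k (z zero) x
  division : ∀ a → ev (suc k) x a ≡
             ev (suc k) ((r ∷ []) + (q * (generator (suc k) zero + (- const (suc k) (z zero))))) a
  division a = trans (ev-division k (z zero) x a)
    (trans (cong₂ Int._+_ (sym (ev-[ r ] a)) (cong₂ (λ v w → ev (suc k) q a Int.* (v Int.- w))
              (sym (ev-generator (suc k) zero a)) (sym (ev-const (suc k) (z zero) a))))
      (sym (ev-step (suc k) (r ∷ []) q (generator (suc k) zero) (const (suc k) (z zero)) a)))
  at-z : ev (suc k) x z ≡ ev k r (tail z)
  at-z = trans (ev-division k (z zero) x z)
    (trans (cong (λ v → ev k r (tail z) Int.+ v) (trans (cong (λ v → ev (suc k) q z Int.* v) (ℤP.+-inverseʳ (z zero)))
                                                  (ℤP.*-zeroʳ (ev (suc k) q z))))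
      (ℤP.+-identityʳ _))

-- The bi-interpretation

module BiInterpretation (k : ℕ) where
  open RingStr (ℤ[x]^ k)
  open IsCongruence (poly-congruence k)
  open Definability (poly-congruence k)
  open ConstantsDefinable k using (IsInteger; isIntegerᵈ; IsInteger⇔const)
  open IntegerInterpretation k
  open PolynomialInterpretation k
  open IntegerCodes using (enc; Value; valueᵈ; Value-ext)
  module ℤᵈ = Definability (poly-congruence 0)

  relative : ∀ {n} → Formula n → Env n → Set
  relative φ ρ = Sat (graph (ℤ[x]^ k)) (relativise integer φ) ρ

  relativeᵈ : ∀ {m n} (φ : Formula m) (f : Fin m → Fin n) → Def n λ ρ → relative φ λ i → ρ (f i)
  relativeᵈ φ f = reindex f (def (relativise integer φ) λ _ → ⇔-refl)

  integerᵈ : ∀ {n} (i : Fin n) → Def n λ ρ → IsInteger (ρ i)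
  integerᵈ i = reindex {n = 1} (λ _ → i) isIntegerᵈ

  congruentᵈ : ∀ {j n} (y a : Fin j → Fin n) (x c : Fin n) →
               Def n λ ρ → Congruent k (λ i → ρ (y i)) (λ i → ρ (a i)) (ρ x) (ρ c)
  congruentᵈ {zero} y a x c = var x ≈ᵈ var c
  congruentᵈ {suc j} y a x c = ∃ᵈ (∃ᵈ (
    (var (suc (suc x)) ≈ᵈ var 0F ⊕ var 1F ⊗ (var (suc (suc (y zero))) ⊕ ⊝ var (suc (suc (a zero))))) ∧ᵈ
    congruentᵈ (λ i → suc (suc (y (suc i)))) (λ i → suc (suc (a (suc i)))) 0F (suc (suc c))))

  valueFormula : Formula (2 ℕ.+ k)
  valueFormula = ℤᵈ.formula (valueᵈ k 0F 1F λ i → suc (suc i))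

  -- The polynomial coded by u, evaluated at y, is x: for all integer points a both have the
  -- same value at y = a, where the value of x is its residue modulo the differences y i − a i.
  HasValueAt : (u x : Carrier) → (y a : Env k) → Set
  HasValueAt u x y a = Σ Carrier λ c → IsInteger c × relative valueFormula (u ∷ᵥ c ∷ᵥ a) × Congruent k y a x c

  Decodes : (u x : Carrier) → Env k → Set
  Decodes u x y = ∀ a → (∀ i → IsInteger (a i)) → HasValueAt u x y a

  opaque
    decodesᵈ : ∀ {n} (u x : Fin n) (y : Fin k → Fin n) → Def n λ ρ → Decodes (ρ u) (ρ x) λ i → ρ (y i)
    decodesᵈ {n} u x y = tuple-∀ᵈ k
      (λ e h p → let (c , c∈ , v , w) = h (λ i → subst IsInteger (sym (e i)) (p i)) in
        c , c∈ , proj₁ (Sat-resp (poly-congruence k) (relativise integer valueFormula)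
                   (λ { 0F → ≈-refl ; 1F → ≈-refl ; (suc (suc i)) → ≡⇒≈ (e i) })) v ,
        Congruent-resp (λ i → ≡⇒≈ (e i)) w)
      (Fin-∀ᵈ k (λ i → integerᵈ (i ↑ˡ n)) ⇒ᵈ
        ∃ᵈ (integerᵈ 0F ∧ᵈ
            def-resp (λ ρ → Sat-resp (poly-congruence k) (relativise integer valueFormula)
                       λ { 0F → ≈-refl ; 1F → ≈-refl ; (suc (suc i)) → ≈-refl })
              (relativeᵈ valueFormula (suc (k ↑ʳ u) ∷ᵥ 0F ∷ᵥ λ i → suc (i ↑ˡ n))) ∧ᵈ
            congruentᵈ (λ i → suc (k ↑ʳ y i)) (λ i → suc (i ↑ˡ n)) (suc (k ↑ʳ x)) 0F))
      where
      ≡⇒≈ : ∀ {a b} → a ≡ b → a ≈ b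
      ≡⇒≈ refl = ≈-refl

  IsCode : Carrier → Set
  IsCode u = IsInteger u × relative isCode (λ (_ : Fin 1) → u)

  isCodeᵈ : ∀ {n} (u : Fin n) → Def n λ ρ → IsCode (ρ u)
  isCodeᵈ u = integerᵈ u ∧ᵈ relativeᵈ isCode (λ _ → u)

  relativeOp : Op → (u v w : Carrier) → Set
  relativeOp o u v w = relative (ℤᵈ.formula (pointwiseᵈ o)) ⟨ u , v , w ⟩

  Respects : Op → Env k → Set
  Respects o y = ∀ u v w p q r → IsCode u → IsCode v → IsCode w →
    Decodes u p y → Decodes v q y → Decodes w r y →
    (relativeOp o u v w → Sat (graph (ℤ[x]^ k)) (atom o) ⟨ p , q , r ⟩) ×
    (Sat (graph (ℤ[x]^ k)) (atom o) ⟨ p , q , r ⟩ → relativeOp o u v w)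

  -- The admissibility condition is that Decodes _ _ y defines a coordinate map.
  record Admissible (y : Env k) : Set where
    field
      total    : ∀ u → IsCode u → Σ Carrier λ x → Decodes u x y
      unique   : ∀ u x x′ → IsCode u → Decodes u x y → Decodes u x′ y → x ≈ x′
      onto     : ∀ x → Σ Carrier λ u → IsCode u × Decodes u x y
      operations : ∀ o → Respects o y

  opaque
    admissibleᵈ : Def k Admissible
    admissibleᵈ = def-resp
      (λ y → (λ (t , u , s , e , a , m , n , z , o) → record
                { total = t ; unique = u ; onto = s
                ; operations = λ { eqᵒ → e ; addᵒ → a ; mulᵒ → m ; negᵒ → n ; zerᵒ → z ; oneᵒ → o } }) ,
             (λ A → let open Admissible A in
                total , unique , onto , operations eqᵒ , operations addᵒ , operations mulᵒ ,
                operations negᵒ , operations zerᵒ , operations oneᵒ))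
      (totalᵈ ∧ᵈ uniqueᵈ ∧ᵈ ontoᵈ ∧ᵈ respectsᵈ eqᵒ ∧ᵈ respectsᵈ addᵒ ∧ᵈ respectsᵈ mulᵒ ∧ᵈ
       respectsᵈ negᵒ ∧ᵈ respectsᵈ zerᵒ ∧ᵈ respectsᵈ oneᵒ)
      where
      totalᵈ : Def k λ y → ∀ u → IsCode u → Σ Carrier λ x → Decodes u x y
      totalᵈ = ∀ᵈ (isCodeᵈ 0F ⇒ᵈ ∃ᵈ (decodesᵈ 1F 0F λ i → suc (suc i)))
      uniqueᵈ : Def k λ y → ∀ u x x′ → IsCode u → Decodes u x y → Decodes u x′ y → x ≈ x′
      uniqueᵈ = ∀ᵈ (∀ᵈ (∀ᵈ (isCodeᵈ 2F ⇒ᵈ decodesᵈ 2F 1F (λ i → suc (suc (suc i))) ⇒ᵈ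
                                         decodesᵈ 2F 0F (λ i → suc (suc (suc i))) ⇒ᵈ (var 1F ≈ᵈ var 0F))))
      ontoᵈ : Def k λ y → ∀ x → Σ Carrier λ u → IsCode u × Decodes u x y
      ontoᵈ = ∀ᵈ (∃ᵈ (isCodeᵈ 0F ∧ᵈ decodesᵈ 0F 1F λ i → suc (suc i)))
      respectsᵈ : ∀ o → Def k (Respects o)
      respectsᵈ o = ∀ᵈ (∀ᵈ (∀ᵈ (∀ᵈ (∀ᵈ (∀ᵈ (
        isCodeᵈ 5F ⇒ᵈ isCodeᵈ 4F ⇒ᵈ isCodeᵈ 3F ⇒ᵈ
        decodesᵈ 5F 2F 6↑ ⇒ᵈ decodesᵈ 4F 1F 6↑ ⇒ᵈ decodesᵈ 3F 0F 6↑ ⇒ᵈ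
        (relativeOpᵈ ⇒ᵈ atomᵈ) ∧ᵈ (atomᵈ ⇒ᵈ relativeOpᵈ)))))))
        where
        6↑ : Fin k → Fin (6 ℕ.+ k)
        6↑ i = suc (suc (suc (suc (suc (suc i)))))
        relativeOpᵈ : Def (6 ℕ.+ k) λ ρ → relativeOp o (ρ 5F) (ρ 4F) (ρ 3F)
        relativeOpᵈ = ternaryᵈ (relativise integer (ℤᵈ.formula (pointwiseᵈ o))) 5F 4F 3F
        atomᵈ : Def (6 ℕ.+ k) λ ρ → Sat (graph (ℤ[x]^ k)) (atom o) ⟨ ρ 2F , ρ 1F , ρ 0F ⟩
        atomᵈ = ternaryᵈ (atom o) 2F 1F 0F

  IsCode⇔enc : ∀ u → IsCode u ⇔ Σ Carrier λ p → u ≈ const k (enc k p)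
  IsCode⇔enc u = to , from
    where
    to : IsCode u → Σ Carrier λ p → u ≈ const k (enc k p)
    to (u∈ , s) =
      let (z , e) = proj₁ (IsInteger⇔const u) u∈
          (p , f) = proj₁ (Sat-isCode λ _ → z) (proj₁ (Sat-relativise-const isCode λ _ → e) s)
      in p , subst (λ v → u ≈ const k v) (sym f) e
    from : (Σ Carrier λ p → u ≈ const k (enc k p)) → IsCode u
    from (p , e) = proj₂ (IsInteger⇔const u) (_ , e) ,
      proj₂ (Sat-relativise-const isCode λ _ → e) (proj₂ (Sat-isCode λ _ → enc k p) (p , refl))

  -- For the generators, the residue of x modulo the differences is its value at the point, so the
  -- condition says that x and p agree at all integer points.
  Decodes-generator : ∀ {u p} x → u ≈ const k (enc k p) → Decodes u x (generator k) ⇔ x ≈ p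
  Decodes-generator {u} {p} x u≈ = to , from
    where
    relativeValue : ∀ {c a z n} → c ≈ const k n → (∀ i → a i ≈ const k (z i)) →
                    relative valueFormula (u ∷ᵥ c ∷ᵥ a) ⇔ Value k (enc k p) n z
    relativeValue {c} {a} {z} {n} e f =
      Sat-relativise-const valueFormula {z = enc k p ∷ᵥ n ∷ᵥ z}
        (λ { 0F → u≈ ; 1F → e ; (suc (suc i)) → f i }) ⇔∘
      ℤᵈ.correct (valueᵈ k 0F 1F λ i → suc (suc i)) _
    to : Decodes u x (generator k) → x ≈ p
    to h = ev⇒≈ k x p λ z →
      let (c , c∈ , v , w) = h (λ i → const k (z i)) (λ i → proj₂ (IsInteger⇔const _) (z i , ≈-refl))
          (n , e) = proj₁ (IsInteger⇔const c) c∈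
          (p′ , f , g) = proj₁ (relativeValue e λ _ → ≈-refl) v
      in trans (Congruent⇒ev z (λ i → trans (ev-generator k i z) (sym (ev-const k (z i) z))) w)
           (trans (≈⇒ev k c _ e z) (trans (ev-const k n z)
             (trans (sym g) (cong (λ t → ev k t z) (IntegerCodes.enc-injective k p′ p f)))))
    from : x ≈ p → Decodes u x (generator k)
    from x≈p a a∈ =
      const k (ev k x z) , proj₂ (IsInteger⇔const _) (_ , ≈-refl) ,
      proj₂ (relativeValue ≈-refl λ i → a≈ i) (p , refl , sym (≈⇒ev k x p x≈p z)) ,
      Congruent-resp (λ i → ≈-sym (a≈ i)) (Congruent-value k x z)
      where
      z : Point k
      z i = proj₁ (proj₁ (IsInteger⇔const (a i)) (a∈ i))
      a≈ : ∀ i → a i ≈ const k (z i)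
      a≈ i = proj₂ (proj₁ (IsInteger⇔const (a i)) (a∈ i))

  generator-admissible : Admissible (generator k)
  generator-admissible = record
    { total = λ u u∈ → let (p , e) = proj₁ (IsCode⇔enc u) u∈ in p , proj₂ (Decodes-generator p e) ≈-refl
    ; unique = λ u x x′ u∈ d d′ → let (p , e) = proj₁ (IsCode⇔enc u) u∈ in
        ≈-trans (proj₁ (Decodes-generator x e) d) (≈-sym (proj₁ (Decodes-generator x′ e) d′))
    ; onto = λ x → const k (enc k x) , proj₂ (IsCode⇔enc _) (x , ≈-refl) , proj₂ (Decodes-generator x ≈-refl) ≈-refl
    ; operations = λ o u v w x y z u∈ v∈ w∈ d d′ d″ →
        let (p , e) = proj₁ (IsCode⇔enc u) u∈
            (q , f) = proj₁ (IsCode⇔enc v) v∈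
            (r , g) = proj₁ (IsCode⇔enc w) w∈
        in Sat-relativise-const (ℤᵈ.formula (pointwiseᵈ o)) {z = ⟨ enc k p , enc k q , enc k r ⟩}
             (λ { 0F → e ; 1F → f ; 2F → g }) ⇔∘
           Sat-pointwise o refl refl refl ⇔∘
           Sat-resp (poly-congruence k) (atom o) (λ
             { 0F → ≈-sym (proj₁ (Decodes-generator x e) d)
             ; 1F → ≈-sym (proj₁ (Decodes-generator y f) d′)
             ; 2F → ≈-sym (proj₁ (Decodes-generator z g) d″) }) }

  -- The composite interpretation of the polynomial ring in itself

  module _ (y : Env k) (admissible : Admissible y) (ps : Fin 0 → Dom (Interp (graph (ℤ[x]^ k)) integers y)) where
    open Admissible admissible

    D T : RelStr
    D = Interp (graph (ℤ[x]^ k)) integers y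
    T = Interp D polynomials ps

    element : Dom T → Carrier
    element u = proj₁ (proj₁ u zero) zero

    isCode-domain : ∀ (u : Fin 1 → Dom D) →
      Sat D isCode (u ++ ps) ⇔ relative isCode (λ (_ : Fin 1) → proj₁ (u zero) zero)
    isCode-domain u = Sat-relativise integer isCode {ρ = u ++ ps} λ { 0F → refl }

    integer-domain : ∀ (x : Fin 1 → Carrier) →
      Sat (graph (ℤ[x]^ k)) (domain integer) (x ++ y) ⇔ IsInteger (x zero)
    integer-domain x = Sat-domain integer (x ++ y) refl ⇔∘ Sat-integer (x zero) ⇔∘ ⇔-sym (IsInteger⇔const (x zero))

    element-code : ∀ u → IsCode (element u)
    element-code (u , s) = proj₁ (integer-domain _) (proj₂ (u zero)) , proj₁ (isCode-domain u) s

    fromCode : ∀ u → IsCode u → Dom T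
    fromCode u (u∈ , s) = let d = (λ _ → u) , proj₂ (integer-domain λ _ → u) u∈ in
      (λ _ → d) , proj₂ (isCode-domain λ _ → d) s

    coordinate : Dom T → Carrier
    coordinate u = proj₁ (total (element u) (element-code u))

    coordinate-decodes : ∀ u → Decodes (element u) (coordinate u) y
    coordinate-decodes u = proj₂ (total (element u) (element-code u))

    Decodes⇔coordinate : ∀ u x → Decodes (element u) x y ⇔ coordinate u ≈ x
    Decodes⇔coordinate u x =
      (λ d → unique _ _ _ (element-code u) (coordinate-decodes u) d) ,
      (λ e → Definability.respects (poly-congruence k) (decodesᵈ 0F 1F λ i → suc (suc i))
        {ρ = element u ∷ᵥ coordinate u ∷ᵥ y} {ρ′ = element u ∷ᵥ x ∷ᵥ y}
        (λ { 0F → ≈-refl ; 1F → e ; (suc (suc i)) → ≈-refl }) (coordinate-decodes u))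

    Sat-operation-coordinate : ∀ o {n} (i j l : Fin n) {ρ : Fin n → Dom D} u v w →
      proj₁ (ρ i) zero ≡ element u → proj₁ (ρ j) zero ≡ element v → proj₁ (ρ l) zero ≡ element w →
      Sat D (operation o i j l) ρ ⇔
      Sat (graph (ℤ[x]^ k)) (atom o) ⟨ coordinate u , coordinate v , coordinate w ⟩
    Sat-operation-coordinate o i j l u v w e f g =
      Sat-operation D o i j l ⇔∘
      Sat-relativise integer (ℤᵈ.formula (pointwiseᵈ o)) {ρ′ = ⟨ element u , element v , element w ⟩}
        (λ { 0F → e ; 1F → f ; 2F → g }) ⇔∘
      operations o _ _ _ _ _ _ (element-code u) (element-code v) (element-code w)
        (coordinate-decodes u) (coordinate-decodes v) (coordinate-decodes w)

    coordinate-map : IsCoordMap T (ℤ[x]^ k) coordinate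
    coordinate-map = record
      { surj = λ x → let (u , u∈ , d) = onto x in
          fromCode u u∈ , proj₁ (Decodes⇔coordinate (fromCode u u∈) x) d
      ; eq  = λ u v → Sat-operation-coordinate eqᵒ 0F 1F 1F u v v refl refl refl
      ; add = λ u v w → Sat-operation-coordinate addᵒ 0F 1F 2F u v w refl refl refl
      ; mul = λ u v w → Sat-operation-coordinate mulᵒ 0F 1F 2F u v w refl refl refl
      ; neg = λ u v → Sat-operation-coordinate negᵒ 0F 1F 1F u v v refl refl refl
      ; zer = λ u → Sat-operation-coordinate zerᵒ 0F 0F 0F u u u refl refl refl
      ; one = λ u → Sat-operation-coordinate oneᵒ 0F 0F 0F u u u refl refl refl }

  -- The formula for the composite interpretation of ℤ in itself: there an integer is represented by
  -- a code u of a constant polynomial, and is recovered as its value at every point. The last n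
  -- variables are the parameters of the composite.
  constantᵈ : ∀ {n} → ℤᵈ.Def (2 ℕ.+ n) λ ρ → ∀ a → Value k (ρ 0F) (ρ 1F) a
  constantᵈ = ℤᵈ.tuple-∀ᵈ k Value-ext (valueᵈ k (k ↑ʳ 0F) (k ↑ʳ 1F) λ i → i ↑ˡ _)

  Value⇔≡ : ∀ {u n p} → enc k p ≡ u → p ≈ const k n → ∀ x → (∀ a → Value k u x a) ⇔ n ≡ x
  Value⇔≡ {u} {n} {p} e p≈n x =
    (λ h → let (q , f , g) = h λ _ → + 0 in
       trans (sym (ev≡n (λ _ → + 0)))
         (trans (cong (λ t → ev k t _) (IntegerCodes.enc-injective k p q (trans e (sym f)))) g)) ,
    (λ { refl a → p , e , ev≡n a })
    where
    ev≡n : ∀ a → ev k p a ≡ n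
    ev≡n a = trans (≈⇒ev k p _ p≈n a) (ev-const k n a)

  bi-interpretation : RegBiInterpretable (ℤ[x]^ k) ℤRing
  bi-interpretation =
    -- The interpretation of ℤ carries k parameters so that the formula for the coordinate map onto
    -- `ℤ[x]^ k` has a tuple in the role of the generators: it sees no parameters but those of the
    -- two interpretations.
    1 , 0 , 1 , k , polynomials , ⊤' , integers , formula admissibleᵈ ,
    (((λ ()) , tt) , λ ps _ → decode ps , decode-coordinate ps) ,
    ((generator k , proj₂ (correct admissibleᵈ _) generator-admissible) ,
     λ qs _ → value (identity-coordinate (poly-congruence k)) qs ,
              value-coordinate (identity-coordinate (poly-congruence k)) qs) ,
    (formula decodes , λ qs ψ ps _ → let A = proj₁ (correct admissibleᵈ qs) ψ in
       coordinate qs A ps , coordinate-map qs A ps ,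
       λ u x → correct decodes _ ⇔∘ Decodes⇔coordinate qs A ps u x) ,
    (ℤᵈ.formula constantᵈ , λ qs _ ps _ →
       value (decode-coordinate qs) ps , value-coordinate (decode-coordinate qs) ps ,
       λ u x → ℤᵈ.correct constantᵈ _ ⇔∘
               Value⇔≡ (enc-decode qs (proj₁ u zero)) (const-value (decode-coordinate qs) ps u) x)
    where
    decodes : Def (2 ℕ.+ k) λ ρ → Decodes (ρ 0F) (ρ 1F) λ i → ρ (suc (suc i))
    decodes = decodesᵈ 0F 1F λ i → suc (suc i)

theorem6p3 : (k : ℕ) → 1 ≤ k → RegBiInterpretable (ℤ[x]^ k) ℤRing
theorem6p3 k _ = BiInterpretation.bi-interpretation k
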